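{- Let $n\ge3$. The map $\zeta_D^*:\mathcal L_{n-1,n}\to\mathcal B_{2n-1}$ defined by $\zeta_D^*(\pi^*)=(\zeta_D(\pi))^*$ for all $\pi\in\mathcal L^\bullet_{n-1,n}$ is well defined and is a bijection.
   Context: $\mathcal L_{n-1,n}$ is the set of words in $\{N,E\}$ with $n-1$ letters $E$ and $n$ letters $N$; $\mathcal B_{2n-1}$ is the set of words of length $2n-1$ in $\{N,E\}$ all of whose prefixes contain at least as many $N$'s as $E$'s. A signed lattice path is an element of $\mathcal L_{n-1,n}$ in which, if the first step is $E$, this step is replaced by $E^+$ or $E^-$ (still counted as an East step); the set is $\mathcal L^\bullet_{n-1,n}$, and $\epsilon(\pi)=-1$ if $\pi$ contains $E^-$, else $1$. A signed ballot path is an element of $\mathcal B_{2n-1}$ in which, if the $n$-th North step is immediately followed by an East step, that East step is replaced by $E^+$ or $E^-$. For a signed path $\rho$, $\rho^*$ is the path obtained by replacing $E^+,E^-$ by $E$. For $\pi\in\mathcal L^\bullet_{n-1,n}$: $\pi_i$ = number of East steps before the $i$-th North step; $\lambda_1=\epsilon(\pi)\pi_1$, $\lambda_i=\pi_i$ ($1<i<n$), $\lambda_n=2\pi_n-\pi_{n-1}$ if $\pi_1+\dots+\pi_{n-2}$ even, $2n-1-2\pi_n+\pi_{n-1}$ if odd; area vector $\mu=(\lambda_1,\lambda_2-1,\dots,\lambda_{n-1}-(n-2),\lambda_n-(n-1))$ if $n-1\equiv0,3\pmod4$ and $\mu=(-\lambda_1,\lambda_2-1,\dots,\lambda_{n-1}-(n-2),n-\lambda_n)$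 if $n-1\equiv1,2\pmod4$. For $a\in\mathbb Z^n$, $j\ge0$: $\overrightarrow{S}^+_j(a)$ reads $a$ left to right writing $N$ for entries $j$, $E$ for entries $j+1$; $\overleftarrow{S}^+_j(a)$ reads right to left; $\overrightarrow{S}^-_j,\overleftarrow{S}^-_j$ likewise with $N$ for $-j$, $E$ for $-j-1$. $\zeta_D(\pi)$ is obtained from $\overleftarrow{S}^-_{2n-1}(\mu)\overrightarrow{S}^+_{2n-1}(\mu)\cdots\overleftarrow{S}^-_0(\mu)\overrightarrow{S}^+_0(\mu)$ by deleting the last letter and, if the $n$-th North step is immediately followed by an East step, replacing that East step by $E^+$ if $\#\{r:\mu_r>0\}$ is even and $E^-$ if odd. -}

module Defs where

open import Data.Nat as ℕ using (ℕ; zero; suc; _∸_; _≤_)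
open import Data.Nat.DivMod using (_%_)
open import Data.Integer as ℤ using (ℤ; +_; -_; 0ℤ; 1ℤ; -1ℤ)
open import Data.List using (List; []; _∷_; _++_; [_]; map; reverse; drop; take; length; downFrom; concatMap)
open import Data.Nat.ListAction using (sum)
open import Data.Bool using (Bool; true; false; if_then_else_)
open import Data.Unit using (⊤)
open import Data.Empty using (⊥)
open import Data.Product using (_×_)
open import Relation.Nullary using (does)
open import Relation.Binary.PropositionalEquality using (_≡_)

data Step : Set where
  N E : Step

data SStep : Set where
  sN sE sE⁺ sE⁻ : SStep

forget : SStep → Step
forget sN  = N
forget sE  = E
forget sE⁺ = E
forget sE⁻ = E

star : List SStep → List Step
star = map forget

plain : Step → SStep
plain N = sN
plain E = sE

countN : List Step → ℕ
countN []      = 0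
countN (N ∷ w) = suc (countN w)
countN (E ∷ w) = countN w

countE : List Step → ℕ
countE []      = 0
countE (N ∷ w) = countE w
countE (E ∷ w) = suc (countE w)

InL : ℕ → List Step → Set
InL n w = (countN w ≡ n) × (countE w ≡ n ∸ 1)

InB : ℕ → List Step → Set
InB n w = (length w ≡ 2 ℕ.* n ∸ 1) × (∀ k → countE (take k w) ≤ countN (take k w))

Plain : List SStep → Set
Plain []         = ⊤
Plain (sN ∷ w)   = Plain w
Plain (sE ∷ w)   = Plain w
Plain (sE⁺ ∷ w)  = ⊥
Plain (sE⁻ ∷ w)  = ⊥

SignOK : List SStep → Set
SignOK []         = ⊤
SignOK (sN ∷ w)   = Plain w
SignOK (sE ∷ w)   = ⊥
SignOK (sE⁺ ∷ w)  = Plain w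
SignOK (sE⁻ ∷ w)  = Plain w

InLsigned : ℕ → List SStep → Set
InLsigned n π = InL n (star π) × SignOK π

hasMinus : List SStep → Bool
hasMinus []         = false
hasMinus (sE⁻ ∷ w)  = true
hasMinus (_ ∷ w)    = hasMinus w

sgn : List SStep → ℤ
sgn π = if hasMinus π then -1ℤ else 1ℤ

eastBefore : ℕ → List Step → List ℕ
eastBefore c []      = []
eastBefore c (N ∷ w) = c ∷ eastBefore c w
eastBefore c (E ∷ w) = eastBefore (suc c) w

-- 1-indexed lookup with default 0
at : List ℕ → ℕ → ℕ
at []       _             = 0
at (x ∷ xs) zero          = 0
at (x ∷ xs) (suc zero)    = x
at (x ∷ xs) (suc (suc i)) = at xs (suc i)

isEven : ℕ → Bool
isEven m = does (m % 2 ℕ.≟ 0)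

module _ (n : ℕ) (π : List SStep) where
  ps : List ℕ
  ps = eastBefore 0 (star π)

  p : ℕ → ℕ
  p = at ps

  lam1 : ℤ
  lam1 = sgn π ℤ.* (+ p 1)

  lamMid : List ℤ
  lamMid = map +_ (take (n ∸ 2) (drop 1 ps))

  lamN : ℤ
  lamN = if isEven (sum (take (n ∸ 2) ps))
         then (+ (2 ℕ.* p n)) ℤ.- (+ p (n ∸ 1))
         else (+ (2 ℕ.* n ∸ 1)) ℤ.- (+ (2 ℕ.* p n)) ℤ.+ (+ p (n ∸ 1))

shiftFrom : ℕ → List ℤ → List ℤ
shiftFrom k []       = []
shiftFrom k (x ∷ xs) = (x ℤ.- + k) ∷ shiftFrom (suc k) xs

mu : ℕ → List SStep → List ℤ
mu n π with (n ∸ 1) % 4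
... | 0 = lam1 n π ∷ (shiftFrom 1 (lamMid n π) ++ [ lamN n π ℤ.- + (n ∸ 1) ])
... | 3 = lam1 n π ∷ (shiftFrom 1 (lamMid n π) ++ [ lamN n π ℤ.- + (n ∸ 1) ])
... | _ = (- lam1 n π) ∷ (shiftFrom 1 (lamMid n π) ++ [ + n ℤ.- lamN n π ])

eqℤ : ℤ → ℤ → Bool
eqℤ x y = does (x ℤ.≟ y)

letterPlus : ℕ → ℤ → List Step
letterPlus j x = if eqℤ x (+ j) then [ N ] else (if eqℤ x (+ suc j) then [ E ] else [])

letterMinus : ℕ → ℤ → List Step
letterMinus j x = if eqℤ x (- + j) then [ N ] else (if eqℤ x (- + suc j) then [ E ] else [])

sweepPlusR : ℕ → List ℤ → List Step
sweepPlusR j a = concatMap (letterPlus j) a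

sweepMinusL : ℕ → List ℤ → List Step
sweepMinusL j a = concatMap (letterMinus j) (reverse a)

sweepWord : ℕ → List ℤ → List Step
sweepWord n a = concatMap (λ j → sweepMinusL j a ++ sweepPlusR j a) (downFrom (2 ℕ.* n))

dropLast : List Step → List Step
dropLast w = reverse (drop 1 (reverse w))

mark : ℕ → SStep → List Step → List SStep
mark k s []                  = []
mark k s (E ∷ w)             = sE ∷ mark k s w
mark zero s (N ∷ w)          = sN ∷ map plain w
mark (suc zero) s (N ∷ [])      = sN ∷ []
mark (suc zero) s (N ∷ N ∷ w)   = sN ∷ sN ∷ map plain w
mark (suc zero) s (N ∷ E ∷ w)   = sN ∷ s ∷ map plain w
mark (suc (suc k)) s (N ∷ w) = sN ∷ mark (suc k) s w

countPos : List ℤ → ℕ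
countPos []       = 0
countPos (x ∷ xs) = if does (0ℤ ℤ.<? x) then suc (countPos xs) else countPos xs

zetaD : ℕ → List SStep → List SStep
zetaD n π = mark n (if isEven (countPos μ) then sE⁺ else sE⁻) (dropLast (sweepWord n μ))
  where μ = mu n π

{-# OPTIONS --safe #-}
module Submission where

-- A path of 𝓛_{n-1,n} with heights h₁, …, hₙ before its North steps is read as a sequence of z = #{i : hᵢ = 0}
-- pairs of plane forests: the hills before and the valleys after each zero.  Read backwards, the sweep word of
-- (h₁, …, hₙ) lists, as runs N Eᵏ, the numbers k of children in breadth-first order of the 2z trees obtained by
-- adding roots to these forests.  A forest is determined by its breadth-first degrees, and the degree sequences
-- that occur are those of the ballot words, so sweeping is a bijection on height vectors.
--
-- The vector μ differs from the heights in its first and last entries only.  The sweep word does not change under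
-- μ₁ ↦ − μ₁, and without its last letter it does not change under μₙ ↦ 1 − μₙ, so that all signs and parities in
-- the definition of μ become irrelevant.  If the path ends with N Eᵏ N Eˡ, then μₙ is k − l or 1 − (k − l); up to
-- this symmetry it is the last height of the path ending with N Eᵏ′ N Eˡ′, where (k′ , l′) = θ (k , l), and θ is
-- a sum-preserving bijection of ℕ × ℕ.

open import Defs
open import Data.Nat using (ℕ; zero; suc; _+_; _*_; _∸_; _≤_; _<_; z≤n; s≤s; s≤s⁻¹)
open import Data.Nat.Properties
open import Data.Nat.DivMod using (_%_)
open import Data.Nat.ListAction using (sum)
open import Data.Nat.ListAction.Properties using (sum-++)
open import Data.Nat.Tactic.RingSolver using (solve-∀)
open import Data.Bool using (true; false; if_then_else_)
open import Data.List using (List; []; _∷_; [_]; _++_; _∷ʳ_; map; reverse; take; drop; length; replicate; concatMap; downFrom)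
open import Data.List.Properties hiding (sum-++)
open import Data.Product using (_×_; Σ; ∃; ∃₂; _,_; proj₁; proj₂)
open import Data.Sum using (_⊎_; inj₁; inj₂)
open import Data.Unit using (⊤; tt)
open import Function using (_∘_)
open import Relation.Binary.PropositionalEquality using (_≡_; refl; sym; trans; cong; cong₂; subst; subst₂; module ≡-Reasoning)

-- Words as sequences of runs

countN-++ : ∀ u v → countN (u ++ v) ≡ countN u + countN v
countN-++ []      v = refl
countN-++ (N ∷ u) v = cong suc (countN-++ u v)
countN-++ (E ∷ u) v = countN-++ u v

countE-++ : ∀ u v → countE (u ++ v) ≡ countE u + countE v
countE-++ []      v = refl
countE-++ (N ∷ u) v = countE-++ u v
countE-++ (E ∷ u) v = cong suc (countE-++ u v)

countN-reverse : ∀ u → countN (reverse u) ≡ countN u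
countN-reverse []      = refl
countN-reverse (x ∷ u) rewrite unfold-reverse x u | countN-++ (reverse u) [ x ] | countN-reverse u
  | +-comm (countN u) (countN [ x ]) = sym (countN-++ [ x ] u)

countE-reverse : ∀ u → countE (reverse u) ≡ countE u
countE-reverse []      = refl
countE-reverse (x ∷ u) rewrite unfold-reverse x u | countE-++ (reverse u) [ x ] | countE-reverse u
  | +-comm (countE u) (countE [ x ]) = sym (countE-++ [ x ] u)

length≡countN+countE : ∀ u → length u ≡ countN u + countE u
length≡countN+countE []      = refl
length≡countN+countE (N ∷ u) = cong suc (length≡countN+countE u)
length≡countN+countE (E ∷ u) = trans (cong suc (length≡countN+countE u)) (sym (+-suc (countN u) (countE u)))

code : List ℕ → List Step
code []       = []
code (k ∷ ks) = N ∷ replicate k E ++ code ks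

code-++ : ∀ ks ls → code (ks ++ ls) ≡ code ks ++ code ls
code-++ []       ls = refl
code-++ (k ∷ ks) ls = cong (N ∷_)
  (trans (cong (replicate k E ++_) (code-++ ks ls)) (sym (++-assoc (replicate k E) (code ks) (code ls))))

countN-code : ∀ ks → countN (code ks) ≡ length ks
countN-run  : ∀ k ks → countN (replicate k E ++ code ks) ≡ length ks
countN-code []       = refl
countN-code (k ∷ ks) = cong suc (countN-run k ks)
countN-run zero    ks = countN-code ks
countN-run (suc k) ks = countN-run k ks

countE-code : ∀ ks → countE (code ks) ≡ sum ks
countE-run  : ∀ k ks → countE (replicate k E ++ code ks) ≡ k + sum ks
countE-code []       = refl
countE-code (k ∷ ks) = countE-run k ks
countE-run zero    ks = countE-code ks
countE-run (suc k) ks = cong suc (countE-run k ks)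

runs : List Step → ℕ × List ℕ
runs []      = 0 , []
runs (N ∷ w) = 0 , proj₁ (runs w) ∷ proj₂ (runs w)
runs (E ∷ w) = suc (proj₁ (runs w)) , proj₂ (runs w)

-- This is `code (k ∷ ks)` without its initial `N`, the shape of a reversed sweep word once its
-- first letter is dropped. It also covers words that start with `E`, which `code` does not.
unrun : ℕ × List ℕ → List Step
unrun (k , ks) = replicate k E ++ code ks

unrun-runs : ∀ w → unrun (runs w) ≡ w
unrun-runs []      = refl
unrun-runs (N ∷ w) = cong (N ∷_) (unrun-runs w)
unrun-runs (E ∷ w) = cong (E ∷_) (unrun-runs w)

runs-unrun : ∀ k ks → runs (unrun (k , ks)) ≡ (k , ks)
runs-unrun zero    []       = refl
runs-unrun zero    (l ∷ ks) rewrite runs-unrun l ks = refl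
runs-unrun (suc k) ks       rewrite runs-unrun k ks = refl

unrun-injective : ∀ k ks l ls → unrun (k , ks) ≡ unrun (l , ls) → (k ≡ l) × (ks ≡ ls)
unrun-injective k ks l ls eq with trans (sym (runs-unrun k ks)) (trans (cong runs eq) (runs-unrun l ls))
... | refl = refl , refl

-- The ballot condition as seen on the reversed word, because degrees are read off a sweep word
-- backwards.
SuffixBallot : List Step → Set
SuffixBallot []      = ⊤
SuffixBallot (x ∷ u) = (countE (x ∷ u) ≤ countN (x ∷ u)) × SuffixBallot u

-- The bound on the suffix right after the letter N of each run.
RunBallot : List ℕ → Set
RunBallot []       = ⊤
RunBallot (k ∷ ks) = (k + sum ks ≤ length ks) × RunBallot ks

suffixBallot-head : ∀ u → SuffixBallot u → countE u ≤ countN u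
suffixBallot-head []      _       = z≤n
suffixBallot-head (x ∷ u) (p , _) = p

suffixBallot-suffix : ∀ p s → SuffixBallot (p ++ s) → SuffixBallot s
suffixBallot-suffix []      s b       = b
suffixBallot-suffix (x ∷ p) s (_ , b) = suffixBallot-suffix p s b

suffixBallot-intro : ∀ u → (∀ p s → u ≡ p ++ s → countE s ≤ countN s) → SuffixBallot u
suffixBallot-intro []      h = tt
suffixBallot-intro (x ∷ u) h = h [] (x ∷ u) refl , suffixBallot-intro u (λ p s eq → h (x ∷ p) s (cong (x ∷_) eq))

-- A suffix starting inside a run has the same `N`s and fewer `E`s than the one right after the `N`
-- of that run, and a suffix starting at an `N` has one `N` more than the one after it.
runBallot⇒suffixBallot : ∀ k ks → RunBallot (k ∷ ks) → SuffixBallot (unrun (k , ks))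
runBallot⇒suffixBallot zero    []       _       = tt
runBallot⇒suffixBallot zero    (l ∷ ks) (_ , b) =
  subst₂ _≤_ (sym (countE-run l ks)) (cong suc (sym (countN-run l ks))) (m≤n⇒m≤1+n (proj₁ b)) ,
  runBallot⇒suffixBallot l ks b
runBallot⇒suffixBallot (suc k) ks       (p , b) =
  subst₂ _≤_ (cong suc (sym (countE-run k ks))) (sym (countN-run k ks)) p ,
  runBallot⇒suffixBallot k ks (≤-trans (n≤1+n _) p , b)

suffixBallot⇒runBallot : ∀ k ks → SuffixBallot (unrun (k , ks)) → RunBallot (k ∷ ks)
suffixBallot⇒runBallot k ks b = subst₂ _≤_ (countE-run k ks) (countN-run k ks) (suffixBallot-head _ b) ,
  tail ks (suffixBallot-suffix (replicate k E) (code ks) b)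
  where
  tail : ∀ ks → SuffixBallot (code ks) → RunBallot ks
  tail []       _       = tt
  tail (l ∷ ks) (_ , b) = suffixBallot⇒runBallot l ks b

PrefixBallot : List Step → Set
PrefixBallot b = ∀ k → countE (take k b) ≤ countN (take k b)

take-length-++ : ∀ {a} {A : Set a} (xs ys : List A) → take (length xs) (xs ++ ys) ≡ xs
take-length-++ []       ys = refl
take-length-++ (x ∷ xs) ys = cong (x ∷_) (take-length-++ xs ys)

suffixBallot⇒prefixBallot : ∀ u → SuffixBallot u → PrefixBallot (reverse u)
suffixBallot⇒prefixBallot u b k = subst₂ _≤_ (countE-reverse t) (countN-reverse t)
  (suffixBallot-head (reverse t) (suffixBallot-suffix (reverse d) (reverse t) (subst SuffixBallot eq b)))
  where
  t = take k (reverse u)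
  d = drop k (reverse u)
  eq : u ≡ reverse d ++ reverse t
  eq = trans (sym (reverse-involutive u))
    (trans (cong reverse (sym (take++drop≡id k (reverse u)))) (reverse-++ t d))

prefixBallot⇒suffixBallot : ∀ b → PrefixBallot b → SuffixBallot (reverse b)
prefixBallot⇒suffixBallot b h = suffixBallot-intro (reverse b) λ p s eq →
  subst₂ _≤_ (countE-reverse s) (countN-reverse s)
    (subst (λ t → countE t ≤ countN t) (prefix p s eq) (h (length (reverse s))))
  where
  prefix : ∀ p s → reverse b ≡ p ++ s → take (length (reverse s)) b ≡ reverse s
  prefix p s eq = trans
    (cong (take (length (reverse s))) (trans (sym (reverse-involutive b)) (trans (cong reverse eq) (reverse-++ p s))))
    (take-length-++ (reverse s) (reverse p))

-- Plane forests and breadth-first degree sequences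

data Tree : Set where
  node : List Tree → Tree

Forest : Set
Forest = List Tree

degs : Forest → List ℕ
degs []           = []
degs (node c ∷ F) = length c ∷ degs F

kids : Forest → Forest
kids []           = []
kids (node c ∷ F) = c ++ kids F

size : Forest → ℕ
size []           = 0
size (node c ∷ F) = suc (size c + size F)

-- The number bounds the levels visited. A nonempty level contains a node, so `size F ≤ d` ensures
-- that `d` levels exhaust `F`.
bfs : ℕ → Forest → List ℕ
bfs zero    F = []
bfs (suc d) F = degs F ++ bfs d (kids F)

degs-++ : ∀ F G → degs (F ++ G) ≡ degs F ++ degs G
degs-++ []           G = refl
degs-++ (node c ∷ F) G = cong (length c ∷_) (degs-++ F G)

kids-++ : ∀ F G → kids (F ++ G) ≡ kids F ++ kids G
kids-++ []           G = refl
kids-++ (node c ∷ F) G = trans (cong (c ++_) (kids-++ F G)) (sym (++-assoc c (kids F) (kids G)))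

size-++ : ∀ F G → size (F ++ G) ≡ size F + size G
size-++ []           G = refl
size-++ (node c ∷ F) G = cong suc (trans (cong (size c +_) (size-++ F G)) (sym (+-assoc (size c) (size F) (size G))))

length-degs : ∀ F → length (degs F) ≡ length F
length-degs []           = refl
length-degs (node c ∷ F) = cong suc (length-degs F)

sum-degs : ∀ F → sum (degs F) ≡ length (kids F)
sum-degs []           = refl
sum-degs (node c ∷ F) = trans (cong (length c +_) (sum-degs F)) (sym (length-++ c))

size-kids : ∀ F → size F ≡ length F + size (kids F)
size-kids []           = refl
size-kids (node c ∷ F) rewrite size-++ c (kids F) | size-kids F =
  cong suc (rearrange (size c) (length F) (size (kids F)))
  where
  rearrange : ∀ a b d → a + (b + d) ≡ b + (a + d)
  rearrange = solve-∀

size-kids-< : ∀ {d} F → size F ≤ suc d → size (kids F) ≤ d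
size-kids-< []           _ = z≤n
size-kids-< (t ∷ F) p = ≤-trans (m≤n+m _ (length F))
  (s≤s⁻¹ (≤-trans (≤-reflexive (sym (size-kids (t ∷ F)))) p))

length-bfs : ∀ d F → size F ≤ d → length (bfs d F) ≡ size F
length-bfs zero    []           p = refl
length-bfs zero    (node _ ∷ _) ()
length-bfs (suc d) F            p = trans (length-++ (degs F))
  (trans (cong₂ _+_ (length-degs F) (length-bfs d (kids F) (size-kids-< F p))) (sym (size-kids F)))

-- Every node that is not a root is counted exactly once as a child.
sum-bfs : ∀ d F → size F ≤ d → sum (bfs d F) + length F ≡ size F
sum-bfs zero    []           p = refl
sum-bfs zero    (node _ ∷ _) ()
sum-bfs (suc d) F            p = begin
  sum (degs F ++ bfs d (kids F)) + length F             ≡⟨ cong (_+ length F) (sum-++ (degs F) _) ⟩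
  sum (degs F) + sum (bfs d (kids F)) + length F        ≡⟨ cong (λ s → s + sum (bfs d (kids F)) + length F) (sum-degs F) ⟩
  length (kids F) + sum (bfs d (kids F)) + length F     ≡⟨ cong (_+ length F) (+-comm (length (kids F)) _) ⟩
  sum (bfs d (kids F)) + length (kids F) + length F     ≡⟨ cong (_+ length F) (sum-bfs d (kids F) (size-kids-< F p)) ⟩
  size (kids F) + length F                              ≡⟨ +-comm (size (kids F)) (length F) ⟩
  length F + size (kids F)                              ≡⟨ size-kids F ⟨
  size F                                                ∎
  where open ≡-Reasoning

runBallot-++ : ∀ ks ls → RunBallot ls → sum ks + sum ls ≤ length ls → RunBallot (ks ++ ls)
runBallot-++ []       ls b p = b
runBallot-++ (k ∷ ks) ls b p =
  ≤-trans (≤-trans (≤-reflexive (trans (cong (k +_) (sum-++ ks ls)) (sym (+-assoc k (sum ks) (sum ls))))) p)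
    (≤-trans (m≤n+m _ (length ks)) (≤-reflexive (sym (length-++ ks)))) ,
  runBallot-++ ks ls b (≤-trans (+-monoˡ-≤ (sum ls) (m≤n+m (sum ks) k)) p)

-- The children of a node and of the nodes after it are distinct, and all of them come later in
-- breadth-first order than that node. At the end of a level this count is exact, and `runBallot-++`
-- carries the bound back through the level.
runBallot-bfs : ∀ d F → size F ≤ d → RunBallot (bfs d F)
runBallot-bfs zero    F p = tt
runBallot-bfs (suc d) F p = runBallot-++ (degs F) (bfs d (kids F)) (runBallot-bfs d (kids F) q) (≤-reflexive (begin
  sum (degs F) + sum (bfs d (kids F))     ≡⟨ cong (_+ sum (bfs d (kids F))) (sum-degs F) ⟩
  length (kids F) + sum (bfs d (kids F))  ≡⟨ +-comm (length (kids F)) _ ⟩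
  sum (bfs d (kids F)) + length (kids F)  ≡⟨ sum-bfs d (kids F) q ⟩
  size (kids F)                           ≡⟨ length-bfs d (kids F) q ⟨
  length (bfs d (kids F))                 ∎))
  where
  open ≡-Reasoning
  q = size-kids-< F p

++-injective : ∀ {a} {A : Set a} (ws xs {ys zs} : List A) → length ws ≡ length xs →
  ws ++ ys ≡ xs ++ zs → (ws ≡ xs) × (ys ≡ zs)
++-injective []       []       _ eq = refl , eq
++-injective (w ∷ ws) (x ∷ xs) p eq with ∷-injective eq
... | refl , eq′ with ++-injective ws xs (suc-injective p) eq′
... | refl , eq″ = refl , eq″

degs-kids-injective : ∀ F G → degs F ≡ degs G → kids F ≡ kids G → F ≡ G
degs-kids-injective []           []           _  _  = refl
degs-kids-injective (node c ∷ F) (node d ∷ G) p q with ∷-injective p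
... | p₁ , p₂ with ++-injective c d p₁ q
... | refl , q₂ = cong (node c ∷_) (degs-kids-injective F G p₂ q₂)
degs-kids-injective []           (node _ ∷ _) () _
degs-kids-injective (node _ ∷ _) []           () _

-- The number of roots tells where the first level ends, and the sum of its degrees is the number of
-- roots of the next level; so the levels can be recovered one after the other.
bfs-injective : ∀ d F G → size F ≤ d → size G ≤ d → length F ≡ length G → bfs d F ≡ bfs d G → F ≡ G
bfs-injective zero    []           []           _ _ _ _ = refl
bfs-injective zero    (node _ ∷ _) _            () _ _ _
bfs-injective zero    []           (node _ ∷ _) _ () _ _
bfs-injective (suc d) F            G            p q l eq
  with ++-injective (degs F) (degs G) (trans (length-degs F) (trans l (sym (length-degs G)))) eq
... | e₁ , e₂ = degs-kids-injective F G e₁ (bfs-injective d (kids F) (kids G) (size-kids-< F p) (size-kids-< G q)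
  (trans (sym (sum-degs F)) (trans (cong sum e₁) (sum-degs G))) e₂)

-- `F` is cut into consecutive blocks whose lengths are the entries of `ks`, and each block receives
-- a parent.
graft : ∀ ks F → length F ≡ sum ks → ∃ λ G → (degs G ≡ ks) × (kids G ≡ F)
graft []       []      _ = [] , refl , refl
graft []       (_ ∷ _) ()
graft (k ∷ ks) F       p with graft ks (drop k F)
  (trans (length-drop k F) (trans (cong (_∸ k) p) (m+n∸m≡n k (sum ks))))
... | G , e₁ , e₂ = node (take k F) ∷ G ,
  cong₂ _∷_ (trans (length-take k F) (m≤n⇒m⊓n≡m (≤-trans (m≤m+n k (sum ks)) (≤-reflexive (sym p))))) e₁ ,
  trans (cong (take k F ++_) e₂) (take++drop≡id k F)

runBallot-drop : ∀ r ks → RunBallot ks → RunBallot (drop r ks)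
runBallot-drop zero    ks       b       = b
runBallot-drop (suc r) []       b       = tt
runBallot-drop (suc r) (k ∷ ks) (_ , b) = runBallot-drop r ks b

bfs-[] : ∀ d → bfs d [] ≡ []
bfs-[] zero    = refl
bfs-[] (suc d) = bfs-[] d

-- The first `r` entries must be the degrees of the roots. The remaining entries satisfy the
-- hypotheses again, now with the sum of those degrees as the number of roots.
bfs-surjective : ∀ d r ks → RunBallot ks → length ks ≡ sum ks + r → length ks ≤ d →
  ∃ λ F → (length F ≡ r) × (size F ≡ length ks) × (bfs d F ≡ ks)
bfs-surjective d       r       []       b p q = [] , p , refl , bfs-[] d
-- With no roots the sum would equal the length of the list, but the ballot bound at the first entry
-- makes it smaller.
bfs-surjective (suc d) zero    (k ∷ ks) (b , _) p q with () ← <-irrefl (trans (sym (+-identityʳ _)) (sym p)) (s≤s b)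
bfs-surjective (suc d) (suc r) (k ∷ ks) b p q =
  G , lenG , sizeG , trans (cong₂ _++_ degsG (trans (cong (bfs d) kidsG) bfsF)) (take++drop≡id (suc r) (k ∷ ks))
  where
  xs = take (suc r) (k ∷ ks)
  ys = drop (suc r) (k ∷ ks)
  lenxs : length xs ≡ suc r
  lenxs = trans (length-take (suc r) (k ∷ ks))
    (m≤n⇒m⊓n≡m (≤-trans (m≤n+m (suc r) (k + sum ks)) (≤-reflexive (sym p))))
  lenys : length ys ≡ sum ys + sum xs
  lenys = begin
    length ys                                ≡⟨ length-drop (suc r) (k ∷ ks) ⟩
    suc (length ks) ∸ suc r                  ≡⟨ cong (_∸ suc r) p ⟩
    k + sum ks + suc r ∸ suc r               ≡⟨ m+n∸n≡m (k + sum ks) (suc r) ⟩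
    sum (k ∷ ks)                             ≡⟨ cong sum (take++drop≡id (suc r) (k ∷ ks)) ⟨
    sum (xs ++ ys)                           ≡⟨ sum-++ xs ys ⟩
    sum xs + sum ys                          ≡⟨ +-comm (sum xs) (sum ys) ⟩
    sum ys + sum xs                          ∎
    where open ≡-Reasoning
  ih = bfs-surjective d (sum xs) ys (runBallot-drop (suc r) (k ∷ ks) b) lenys
    (≤-trans (≤-reflexive (length-drop (suc r) (k ∷ ks))) (≤-trans (m∸n≤m (length ks) r) (s≤s⁻¹ q)))
  F = proj₁ ih
  sizeF = proj₁ (proj₂ (proj₂ ih))
  bfsF  = proj₂ (proj₂ (proj₂ ih))
  g = graft xs F (proj₁ (proj₂ ih))
  G = proj₁ g
  degsG = proj₁ (proj₂ g)
  kidsG = proj₂ (proj₂ g)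
  lenG : length G ≡ suc r
  lenG = trans (sym (length-degs G)) (trans (cong length degsG) lenxs)
  sizeG : size G ≡ suc (length ks)
  sizeG = begin
    size G                       ≡⟨ size-kids G ⟩
    length G + size (kids G)     ≡⟨ cong₂ _+_ (trans lenG (sym lenxs)) (trans (cong size kidsG) sizeF) ⟩
    length xs + length ys        ≡⟨ length-++ xs ⟨
    length (xs ++ ys)            ≡⟨ cong length (take++drop≡id (suc r) (k ∷ ks)) ⟩
    suc (length ks)              ∎
    where open ≡-Reasoning
bfs-surjective zero    r       (_ ∷ _)  b p ()

-- Paths as sequences of pairs of forests

open import Data.Integer as ℤ using (ℤ; +_; -_; -[1+_]; 0ℤ; 1ℤ; _⊖_)
import Data.Integer.Properties as ℤ
import Data.Integer.Tactic.RingSolver as ℤ-Solver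

-- The trees are laid out from last to first and the `N` of a node comes after its children, so the
-- heights read backwards are the depths in preorder. In `valleys` the `N` comes first and the order
-- is forward, so there the depths appear negated and in preorder directly.
hills : Forest → List Step
hills []           = []
hills (node c ∷ F) = hills F ++ E ∷ hills c ++ [ N ]

valleys : Forest → List Step
valleys []           = []
valleys (node c ∷ F) = N ∷ valleys c ++ E ∷ valleys F

-- The path, with an extra initial E, whose k-th North step from height 0 to height −1 is preceded by the
-- hills of the first and followed by the valleys of the second component of the k-th entry.
path : List (Forest × Forest) → List Step
path []             = []
path ((P , Q) ∷ ps) = E ∷ hills P ++ N ∷ valleys Q ++ path ps

-- A zero height gets a letter in both sweeps of level 0, so it is a root twice: over its hills in
-- `leftTrees`, over its valleys in `rightTrees`. Reversing the sweep word turns the rightward sweep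
-- around, hence the reversed order here.
leftTrees : List (Forest × Forest) → Forest
leftTrees []             = []
leftTrees ((P , Q) ∷ ps) = leftTrees ps ++ [ node P ]

rightTrees : List (Forest × Forest) → Forest
rightTrees []             = []
rightTrees ((P , Q) ∷ ps) = node Q ∷ rightTrees ps

forest : List (Forest × Forest) → Forest
forest ps = leftTrees ps ++ rightTrees ps

length-leftTrees : ∀ ps → length (leftTrees ps) ≡ length ps
length-leftTrees []             = refl
length-leftTrees ((P , Q) ∷ ps) = trans (length-++ (leftTrees ps))
  (trans (+-comm (length (leftTrees ps)) 1) (cong suc (length-leftTrees ps)))

length-rightTrees : ∀ ps → length (rightTrees ps) ≡ length ps
length-rightTrees []       = refl
length-rightTrees (p ∷ ps) = cong suc (length-rightTrees ps)

length-forest : ∀ ps → length (forest ps) ≡ length ps + length ps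
length-forest ps = trans (length-++ (leftTrees ps)) (cong₂ _+_ (length-leftTrees ps) (length-rightTrees ps))

trees-injective : ∀ ps qs → leftTrees ps ≡ leftTrees qs → rightTrees ps ≡ rightTrees qs → ps ≡ qs
trees-injective []             []             _ _ = refl
trees-injective ((P , Q) ∷ ps) ((R , S) ∷ qs) e f
  with ∷ʳ-injective (leftTrees ps) (leftTrees qs) e | ∷-injective f
... | e₁ , refl | refl , f₂ = cong ((P , Q) ∷_) (trees-injective ps qs e₁ f₂)
trees-injective []             (_ ∷ _)        _ ()
trees-injective (_ ∷ _)        []             _ ()

forest-injective : ∀ ps qs → length ps ≡ length qs → forest ps ≡ forest qs → ps ≡ qs
forest-injective ps qs l e
  with ++-injective (leftTrees ps) (leftTrees qs) (trans (length-leftTrees ps) (trans l (sym (length-leftTrees qs)))) e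
... | e₁ , e₂ = trees-injective ps qs e₁ e₂

trees-surjective : ∀ F G → length F ≡ length G → ∃ λ ps → (leftTrees ps ≡ reverse F) × (rightTrees ps ≡ G)
trees-surjective []           []           _ = [] , refl , refl
trees-surjective (node P ∷ F) (node Q ∷ G) l with trees-surjective F G (suc-injective l)
... | ps , e₁ , e₂ = (P , Q) ∷ ps , trans (cong (_++ [ node P ]) e₁) (sym (unfold-reverse (node P) F)) , cong (node Q ∷_) e₂
trees-surjective []           (_ ∷ _)      ()
trees-surjective (_ ∷ _)      []           ()

forest-surjective : ∀ z F → length F ≡ z + z → ∃ λ ps → (length ps ≡ z) × (forest ps ≡ F)
forest-surjective z F l =
  proj₁ s ,
  trans (sym (length-leftTrees (proj₁ s))) (trans (cong length e₁) l₁) ,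
  trans (cong₂ _++_ e₁ (proj₂ (proj₂ s))) (take++drop≡id z F)
  where
  l₁ : length (take z F) ≡ z
  l₁ = trans (length-take z F) (m≤n⇒m⊓n≡m (≤-trans (m≤m+n z z) (≤-reflexive (sym l))))
  l₂ : length (drop z F) ≡ z
  l₂ = trans (length-drop z F) (trans (cong (_∸ z) l) (m+n∸n≡m z z))
  s = trees-surjective (reverse (take z F)) (drop z F) (trans (length-reverse (take z F)) (trans l₁ (sym l₂)))
  e₁ : leftTrees (proj₁ s) ≡ take z F
  e₁ = trans (proj₁ (proj₂ s)) (reverse-involutive (take z F))

countN-hills : ∀ F → countN (hills F) ≡ size F
countN-hills []           = refl
countN-hills (node c ∷ F) rewrite countN-++ (hills F) (E ∷ hills c ++ [ N ]) | countN-++ (hills c) [ N ]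
  | countN-hills F | countN-hills c = rearrange (size F) (size c)
  where
  rearrange : ∀ a b → a + (b + 1) ≡ suc (b + a)
  rearrange = solve-∀

countE-hills : ∀ F → countE (hills F) ≡ size F
countE-hills []           = refl
countE-hills (node c ∷ F) rewrite countE-++ (hills F) (E ∷ hills c ++ [ N ]) | countE-++ (hills c) [ N ]
  | countE-hills F | countE-hills c = rearrange (size F) (size c)
  where
  rearrange : ∀ a b → a + suc (b + 0) ≡ suc (b + a)
  rearrange = solve-∀

countN-valleys : ∀ F → countN (valleys F) ≡ size F
countN-valleys []           = refl
countN-valleys (node c ∷ F) rewrite countN-++ (valleys c) (E ∷ valleys F)
  | countN-valleys F | countN-valleys c = refl

countE-valleys : ∀ F → countE (valleys F) ≡ size F
countE-valleys []           = refl
countE-valleys (node c ∷ F) rewrite countE-++ (valleys c) (E ∷ valleys F)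
  | countE-valleys F | countE-valleys c = +-suc (size c) (size F)

-- Each North step is one node, except that those at height 0 are roots on both sides.
size-forest : ∀ ps → size (forest ps) ≡ countN (path ps) + length ps
size-forest ps = trans (size-++ (leftTrees ps) (rightTrees ps)) (go ps)
  where
  rearrange : ∀ a b c d p q → a + b ≡ c + d → a + suc (p + 0) + suc (q + b) ≡ p + suc (q + c) + suc d
  rearrange a b c d p q h = trans (lhs a b p q) (trans (cong (_+ (2 + p + q)) h) (rhs c d p q))
    where
    lhs : ∀ a b p q → a + suc (p + 0) + suc (q + b) ≡ a + b + (2 + p + q)
    lhs = solve-∀
    rhs : ∀ c d p q → c + d + (2 + p + q) ≡ p + suc (q + c) + suc d
    rhs = solve-∀
  go : ∀ ps → size (leftTrees ps) + size (rightTrees ps) ≡ countN (path ps) + length ps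
  go []             = refl
  go ((P , Q) ∷ ps) rewrite size-++ (leftTrees ps) [ node P ] | countN-++ (hills P) (N ∷ valleys Q ++ path ps)
    | countN-++ (valleys Q) (path ps) | countN-hills P | countN-valleys Q =
    rearrange (size (leftTrees ps)) (size (rightTrees ps)) (countN (path ps)) (length ps) (size P) (size Q) (go ps)

path-balanced : ∀ ps → countN (path ps) ≡ countE (path ps)
path-balanced []             = refl
path-balanced ((P , Q) ∷ ps) rewrite countN-++ (hills P) (N ∷ valleys Q ++ path ps)
  | countE-++ (hills P) (N ∷ valleys Q ++ path ps)
  | countN-++ (valleys Q) (path ps) | countE-++ (valleys Q) (path ps)
  | countN-hills P | countN-valleys Q | countE-hills P | countE-valleys Q | path-balanced ps =
  +-suc (size P) (size Q + countE (path ps))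

climb : List Forest → List Step → List Step
climb []       w = w
climb (R ∷ Rs) w = hills R ++ N ∷ climb Rs w

dive : List Forest → List Step → List Step
dive []       w = w
dive (Q ∷ Qs) w = E ∷ valleys Q ++ dive Qs w

-- A suffix of a path ending at height −1 that starts at height ≥ 0 (high) or < 0 (low).
data Suffix : Set where
  high : List Forest → Forest → Forest → List (Forest × Forest) → Suffix
  low  : Forest → List Forest → List (Forest × Forest) → Suffix

steps : Suffix → List Step
steps (high Rs P Q ps) = climb Rs (hills P ++ N ∷ valleys Q ++ path ps)
steps (low Q Qs ps)    = valleys Q ++ dive Qs (path ps)

hills-++ : ∀ F G → hills (F ++ G) ≡ hills G ++ hills F
hills-++ []           G = sym (++-identityʳ (hills G))
hills-++ (node c ∷ F) G = trans (cong (_++ E ∷ hills c ++ [ N ]) (hills-++ F G)) (++-assoc (hills G) (hills F) _)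

prepend-hill : ∀ R F w → hills (F ++ [ node R ]) ++ w ≡ E ∷ hills R ++ N ∷ hills F ++ w
prepend-hill R F w = trans (cong (_++ w) (hills-++ F [ node R ]))
  (cong (E ∷_) (trans (++-assoc (hills R ++ [ N ]) (hills F) w) (++-assoc (hills R) [ N ] (hills F ++ w))))

-- The word is read from its end, and each prepended letter moves the starting height by one. An `N`
-- opens a hill, or closes a valley into a first node; an `E` opens a valley, or closes a hill into
-- a last node. Between heights 0 and -1, `N` starts a new pair of forests and `E` completes it.
path-suffix : ∀ w → ∃ λ s → steps s ≡ w
path-suffix []      = low [] [] [] , refl
path-suffix (x ∷ w) with path-suffix w
path-suffix (N ∷ w) | high Rs P Q ps       , refl = high ([] ∷ Rs) P Q ps , refl
path-suffix (N ∷ w) | low Q [] ps          , refl = high [] [] Q ps , refl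
path-suffix (N ∷ w) | low Q (R ∷ Qs) ps    , refl = low (node Q ∷ R) Qs ps ,
  cong (N ∷_) (++-assoc (valleys Q) (E ∷ valleys R) _)
path-suffix (E ∷ w) | high [] P Q ps       , refl = low [] [] ((P , Q) ∷ ps) , refl
path-suffix (E ∷ w) | high (R ∷ []) P Q ps , refl = high [] (P ++ [ node R ]) Q ps , prepend-hill R P _
path-suffix (E ∷ w) | high (R ∷ S ∷ Rs) P Q ps , refl = high ((S ++ [ node R ]) ∷ Rs) P Q ps , prepend-hill R S _
path-suffix (E ∷ w) | low Q Qs ps          , refl = low [] (Q ∷ Qs) ps , refl

climb-balance : ∀ Rs {w} → countN w ≡ suc (countE w) → countN (climb Rs w) ≡ suc (length Rs + countE (climb Rs w))
climb-balance []           h = h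
climb-balance (R ∷ Rs) {w} h rewrite countN-++ (hills R) (N ∷ climb Rs w) | countE-++ (hills R) (N ∷ climb Rs w)
  | countN-hills R | countE-hills R | climb-balance Rs {w} h = rearrange (size R) (length Rs) (countE (climb Rs w))
  where
  rearrange : ∀ a b c → a + suc (suc (b + c)) ≡ suc (suc (b + (a + c)))
  rearrange = solve-∀

dive-balance : ∀ Qs {w} → countN w ≡ countE w → countN (dive Qs w) ≤ countE (dive Qs w)
dive-balance []           h = ≤-reflexive h
dive-balance (Q ∷ Qs) {w} h rewrite countN-++ (valleys Q) (dive Qs w) | countE-++ (valleys Q) (dive Qs w)
  | countN-valleys Q | countE-valleys Q = m≤n⇒m≤1+n (+-monoʳ-≤ (size Q) (dive-balance Qs h))

low-balance : ∀ Q Qs ps → countN (steps (low Q Qs ps)) ≤ countE (steps (low Q Qs ps))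
low-balance Q Qs ps rewrite countN-++ (valleys Q) (dive Qs (path ps)) | countE-++ (valleys Q) (dive Qs (path ps))
  | countN-valleys Q | countE-valleys Q = +-monoʳ-≤ (size Q) (dive-balance Qs (path-balanced ps))

-- The suffix ends at height -1, so one more `N` than `E` means that it starts at height 0; the
-- counts exclude every form but `high []`.
path-surjective : ∀ w → countN w ≡ suc (countE w) → ∃ λ p → ∃ λ ps → path (p ∷ ps) ≡ E ∷ w
path-surjective w h with path-suffix w
... | high [] P Q ps , refl = (P , Q) , ps , refl
... | high (R ∷ Rs) P Q ps , refl
  with () ← m≢1+n+m (countE w) (suc-injective (trans (sym h)
         (climb-balance (R ∷ Rs) {hills P ++ N ∷ valleys Q ++ path ps} (path-balanced ((P , Q) ∷ ps)))))
path-surjective w h | low Q Qs ps , refl with () ← <-irrefl refl (≤-trans (≤-reflexive (sym h)) (low-balance Q Qs ps))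

-- Started at `0ℤ`, the i-th entry is π_i - (i - 1), the area vector before the first and last
-- entries are modified.
area : ℤ → List Step → List ℤ
area h []      = []
area h (N ∷ w) = h ∷ area (ℤ.pred h) w
area h (E ∷ w) = area (ℤ.suc h) w

preorder : ℕ → Forest → List ℕ
preorder d []           = []
preorder d (node c ∷ F) = d ∷ preorder (suc d) c ++ preorder d F

values : List (Forest × Forest) → List ℤ
values []             = []
values ((P , Q) ∷ ps) = reverse (map +_ (preorder 1 P)) ++ 0ℤ ∷ map (-_ ∘ +_) (preorder 1 Q) ++ values ps

area-hills : ∀ d F w → area (+ d) (hills F ++ w) ≡ reverse (map +_ (preorder (suc d) F)) ++ area (+ d) w
area-hills d []           w = refl
area-hills d (node c ∷ F) w = begin
  area (+ d) ((hills F ++ E ∷ hills c ++ [ N ]) ++ w)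
    ≡⟨ cong (area (+ d)) (trans (++-assoc (hills F) _ w) (cong (λ v → hills F ++ E ∷ v) (++-assoc (hills c) [ N ] w))) ⟩
  area (+ d) (hills F ++ E ∷ hills c ++ N ∷ w)
    ≡⟨ area-hills d F _ ⟩
  rF ++ area (+ suc d) (hills c ++ N ∷ w)
    ≡⟨ cong (rF ++_) (area-hills (suc d) c _) ⟩
  rF ++ rc ++ + suc d ∷ area (+ d) w
    ≡⟨ cong (rF ++_) (trans (sym (++-assoc rc [ + suc d ] _))
         (cong (_++ area (+ d) w) (sym (unfold-reverse (+ suc d) (map +_ (preorder (suc (suc d)) c)))))) ⟩
  rF ++ reverse (map +_ (suc d ∷ preorder (suc (suc d)) c)) ++ area (+ d) w
    ≡⟨ ++-assoc rF _ _ ⟨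
  (rF ++ reverse (map +_ (suc d ∷ preorder (suc (suc d)) c))) ++ area (+ d) w
    ≡⟨ cong (_++ area (+ d) w) (reverse-++ (map +_ (suc d ∷ preorder (suc (suc d)) c)) (map +_ (preorder (suc d) F))) ⟨
  reverse (map +_ (suc d ∷ preorder (suc (suc d)) c) ++ map +_ (preorder (suc d) F)) ++ area (+ d) w
    ≡⟨ cong (λ v → reverse v ++ area (+ d) w) (map-++ +_ (suc d ∷ preorder (suc (suc d)) c) (preorder (suc d) F)) ⟨
  reverse (map +_ (preorder (suc d) (node c ∷ F))) ++ area (+ d) w ∎
  where
  open ≡-Reasoning
  rF = reverse (map +_ (preorder (suc d) F))
  rc = reverse (map +_ (preorder (suc (suc d)) c))

area-valleys : ∀ d F w → area -[1+ d ] (valleys F ++ w) ≡ map (-_ ∘ +_) (preorder (suc d) F) ++ area -[1+ d ] w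
area-valleys d []           w = refl
area-valleys d (node c ∷ F) w = cong (-[1+ d ] ∷_) (begin
  area -[1+ suc d ] ((valleys c ++ E ∷ valleys F) ++ w)
    ≡⟨ cong (area -[1+ suc d ]) (++-assoc (valleys c) _ w) ⟩
  area -[1+ suc d ] (valleys c ++ E ∷ valleys F ++ w)
    ≡⟨ area-valleys (suc d) c _ ⟩
  map (-_ ∘ +_) (preorder (suc (suc d)) c) ++ area -[1+ d ] (valleys F ++ w)
    ≡⟨ cong (map (-_ ∘ +_) (preorder (suc (suc d)) c) ++_) (area-valleys d F w) ⟩
  map (-_ ∘ +_) (preorder (suc (suc d)) c) ++ map (-_ ∘ +_) (preorder (suc d) F) ++ area -[1+ d ] w
    ≡⟨ ++-assoc (map (-_ ∘ +_) (preorder (suc (suc d)) c)) _ _ ⟨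
  (map (-_ ∘ +_) (preorder (suc (suc d)) c) ++ map (-_ ∘ +_) (preorder (suc d) F)) ++ area -[1+ d ] w
    ≡⟨ cong (_++ area -[1+ d ] w) (map-++ (-_ ∘ +_) (preorder (suc (suc d)) c) _) ⟨
  map (-_ ∘ +_) (preorder (suc (suc d)) c ++ preorder (suc d) F) ++ area -[1+ d ] w ∎)
  where open ≡-Reasoning

area-path : ∀ ps → area -[1+ 0 ] (path ps) ≡ values ps
area-path []             = refl
area-path ((P , Q) ∷ ps) = trans (area-hills 0 P _) (cong (λ v → reverse (map +_ (preorder 1 P)) ++ 0ℤ ∷ v)
  (trans (area-valleys 0 Q (path ps)) (cong (map (-_ ∘ +_) (preorder 1 Q) ++_) (area-path ps))))

-- Sweeping level by level

-- The common form of both sweeps on absolute values: the rightward one sees only nonnegative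
-- entries, the leftward one only nonpositive entries.
letter : ℕ → ℕ → List Step
letter zero    zero          = [ N ]
letter zero    (suc zero)    = [ E ]
letter zero    (suc (suc d)) = []
letter (suc j) zero          = []
letter (suc j) (suc d)       = letter j d

letterPlus-+ : ∀ j d → letterPlus j (+ d) ≡ letter j d
letterPlus-+ zero    zero          = refl
letterPlus-+ zero    (suc zero)    = refl
letterPlus-+ zero    (suc (suc d)) = refl
letterPlus-+ (suc j) zero          = refl
letterPlus-+ (suc j) (suc d)       = letterPlus-+ j d

letterMinus-neg : ∀ j x → letterMinus j (- x) ≡ letterPlus j x
letterMinus-neg zero    (+ zero)  = refl
letterMinus-neg (suc j) (+ zero)  = refl
letterMinus-neg zero    (+ suc d) = refl
letterMinus-neg (suc j) (+ suc d) = refl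
letterMinus-neg zero    -[1+ d ]  = refl
letterMinus-neg (suc j) -[1+ d ]  = refl

letterMinus-+ : ∀ j d → letterMinus j (+ suc d) ≡ []
letterMinus-+ zero    d = refl
letterMinus-+ (suc j) d = refl

letterPlus-neg : ∀ j d → letterPlus j -[1+ d ] ≡ []
letterPlus-neg zero    d = refl
letterPlus-neg (suc j) d = refl

degsAt : ℕ → Forest → List ℕ
degsAt zero    F = degs F
degsAt (suc j) F = degsAt j (kids F)

degsAt-++ : ∀ j F G → degsAt j (F ++ G) ≡ degsAt j F ++ degsAt j G
degsAt-++ zero    F G = degs-++ F G
degsAt-++ (suc j) F G = trans (cong (degsAt j) (kids-++ F G)) (degsAt-++ j (kids F) (kids G))

bfs-last : ∀ d F → bfs (suc d) F ≡ bfs d F ++ degsAt d F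
bfs-last zero    F = ++-identityʳ (degs F)
bfs-last (suc d) F = trans (cong (degs F ++_) (bfs-last d (kids F))) (sym (++-assoc (degs F) _ _))

level : ℕ → ℕ → Forest → List Step
level j d F = concatMap (letter j) (preorder d F)

level-node : ∀ j d c F → level j d (node c ∷ F) ≡ letter j d ++ level j (suc d) c ++ level j d F
level-node j d c F = cong (letter j d ++_) (concatMap-++ (letter j) (preorder (suc d) c) (preorder d F))

level-suc : ∀ j d F → level (suc j) (suc d) F ≡ level j d F
level-suc j d []           = refl
level-suc j d (node c ∷ F) = trans (level-node (suc j) (suc d) c F)
  (trans (cong (letter j d ++_) (cong₂ _++_ (level-suc j (suc d) c) (level-suc j d F))) (sym (level-node j d c F)))

level-0-2+ : ∀ d F → level 0 (suc (suc d)) F ≡ []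
level-0-2+ d []           = refl
level-0-2+ d (node c ∷ F) = trans (level-node 0 (suc (suc d)) c F) (cong₂ _++_ (level-0-2+ (suc d) c) (level-0-2+ d F))

level-0-1 : ∀ F → level 0 1 F ≡ replicate (length F) E
level-0-1 []           = refl
level-0-1 (node c ∷ F) = trans (level-node 0 1 c F) (cong (E ∷_) (cong₂ _++_ (level-0-2+ 0 c) (level-0-1 F)))

-- In preorder the children of a node of depth `j` come after it and before the next node of depth
-- `j`. Writing `N` for depth `j` and `E` for depth `j + 1` therefore produces one run per node,
-- whose length is its degree.
level-degsAt : ∀ j F → level j 0 F ≡ code (degsAt j F)
level-degsAt zero    []           = refl
level-degsAt zero    (node c ∷ F) = trans (level-node 0 0 c F) (cong (N ∷_) (cong₂ _++_ (level-0-1 c) (level-degsAt 0 F)))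
level-degsAt (suc j) []           = level-degsAt j []
level-degsAt (suc j) (node c ∷ F) = begin
  level (suc j) 0 (node c ∷ F)                      ≡⟨ level-node (suc j) 0 c F ⟩
  level (suc j) 1 c ++ level (suc j) 0 F            ≡⟨ cong₂ _++_ (trans (level-suc j 0 c) (level-degsAt j c)) (level-degsAt (suc j) F) ⟩
  code (degsAt j c) ++ code (degsAt j (kids F))     ≡⟨ code-++ (degsAt j c) _ ⟨
  code (degsAt j c ++ degsAt j (kids F))            ≡⟨ cong code (degsAt-++ j c (kids F)) ⟨
  code (degsAt j (c ++ kids F))                     ∎
  where open ≡-Reasoning

level-root : ∀ j c → letter j 0 ++ level j 1 c ≡ code (degsAt j [ node c ])
level-root j c = trans (cong (letter j 0 ++_) (sym (++-identityʳ _)))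
  (trans (sym (level-node j 0 c [])) (level-degsAt j [ node c ]))

reverse-concatMap : ∀ {a b} {A : Set a} {B : Set b} (f : A → List B) → (∀ x → reverse (f x) ≡ f x) →
  ∀ xs → reverse (concatMap f xs) ≡ concatMap f (reverse xs)
reverse-concatMap f h []       = refl
reverse-concatMap f h (x ∷ xs) = begin
  reverse (f x ++ concatMap f xs)                ≡⟨ reverse-++ (f x) _ ⟩
  reverse (concatMap f xs) ++ reverse (f x)      ≡⟨ cong₂ _++_ (reverse-concatMap f h xs) (trans (h x) (sym (++-identityʳ (f x)))) ⟩
  concatMap f (reverse xs) ++ concatMap f [ x ]  ≡⟨ concatMap-++ f (reverse xs) [ x ] ⟨
  concatMap f (reverse xs ∷ʳ x)                  ≡⟨ cong (concatMap f) (unfold-reverse x xs) ⟨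
  concatMap f (reverse (x ∷ xs))                 ∎
  where open ≡-Reasoning

reverse-letter : ∀ j d → reverse (letter j d) ≡ letter j d
reverse-letter zero    zero          = refl
reverse-letter zero    (suc zero)    = refl
reverse-letter zero    (suc (suc d)) = refl
reverse-letter (suc j) zero          = refl
reverse-letter (suc j) (suc d)       = reverse-letter j d

reverse-letterPlus : ∀ j x → reverse (letterPlus j x) ≡ letterPlus j x
reverse-letterPlus j (+ d)    rewrite letterPlus-+ j d = reverse-letter j d
reverse-letterPlus j -[1+ d ] rewrite letterPlus-neg j d = refl

reverse-letterMinus : ∀ j x → reverse (letterMinus j x) ≡ letterMinus j x
reverse-letterMinus j x = subst (λ y → reverse (letterMinus j y) ≡ letterMinus j y) (ℤ.neg-involutive x)
  (trans (cong reverse (letterMinus-neg j (- x))) (trans (reverse-letterPlus j (- x)) (sym (letterMinus-neg j (- x)))))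

concatMap-+ : ∀ j ds → concatMap (letterPlus j) (map +_ ds) ≡ concatMap (letter j) ds
concatMap-+ j ds = trans (concatMap-map (letterPlus j) +_ ds) (concatMap-cong (letterPlus-+ j) ds)

concatMap-neg : ∀ j ds → concatMap (letterMinus j) (map (-_ ∘ +_) ds) ≡ concatMap (letter j) ds
concatMap-neg j ds = trans (concatMap-map (letterMinus j) (-_ ∘ +_) ds)
  (concatMap-cong (λ d → trans (letterMinus-neg j (+ d)) (letterPlus-+ j d)) ds)

concatMap-plus-neg : ∀ j d F → concatMap (letterPlus j) (map (-_ ∘ +_) (preorder (suc d) F)) ≡ []
concatMap-plus-neg j d []           = refl
concatMap-plus-neg j d (node c ∷ F) rewrite letterPlus-neg j d
  | map-++ (-_ ∘ +_) (preorder (suc (suc d)) c) (preorder (suc d) F)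
  | concatMap-++ (letterPlus j) (map (-_ ∘ +_) (preorder (suc (suc d)) c)) (map (-_ ∘ +_) (preorder (suc d) F))
  | concatMap-plus-neg j (suc d) c = concatMap-plus-neg j d F

concatMap-minus-+ : ∀ j d F → concatMap (letterMinus j) (map +_ (preorder (suc d) F)) ≡ []
concatMap-minus-+ j d []           = refl
concatMap-minus-+ j d (node c ∷ F) rewrite letterMinus-+ j d
  | map-++ +_ (preorder (suc (suc d)) c) (preorder (suc d) F)
  | concatMap-++ (letterMinus j) (map +_ (preorder (suc (suc d)) c)) (map +_ (preorder (suc d) F))
  | concatMap-minus-+ j (suc d) c = concatMap-minus-+ j d F

concatMap-values : ∀ (f : ℤ → List Step) P Q ps → concatMap f (values ((P , Q) ∷ ps)) ≡
  concatMap f (reverse (map +_ (preorder 1 P))) ++ f 0ℤ ++ concatMap f (map (-_ ∘ +_) (preorder 1 Q)) ++ concatMap f (values ps)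
concatMap-values f P Q ps = trans (concatMap-++ f (reverse (map +_ (preorder 1 P))) _)
  (cong (λ v → concatMap f (reverse (map +_ (preorder 1 P))) ++ f 0ℤ ++ v)
    (concatMap-++ f (map (-_ ∘ +_) (preorder 1 Q)) (values ps)))

reverse-sweepPlusR : ∀ j ps → reverse (sweepPlusR j (values ps)) ≡ code (degsAt j (leftTrees ps))
reverse-sweepPlusR zero    [] = refl
reverse-sweepPlusR (suc j) [] = reverse-sweepPlusR j []
reverse-sweepPlusR j ((P , Q) ∷ ps) = begin
  reverse (sweepPlusR j (values ((P , Q) ∷ ps)))
    ≡⟨ cong reverse (concatMap-values (letterPlus j) P Q ps) ⟩
  reverse (sweepPlusR j (reverse positive) ++ letterPlus j 0ℤ ++ sweepPlusR j (map (-_ ∘ +_) (preorder 1 Q)) ++ rest)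
    ≡⟨ cong (λ v → reverse (sweepPlusR j (reverse positive) ++ letterPlus j 0ℤ ++ v ++ rest)) (concatMap-plus-neg j 0 Q) ⟩
  reverse (sweepPlusR j (reverse positive) ++ letterPlus j 0ℤ ++ rest)
    ≡⟨ reverse-++ (sweepPlusR j (reverse positive)) _ ⟩
  reverse (letterPlus j 0ℤ ++ rest) ++ reverse (sweepPlusR j (reverse positive))
    ≡⟨ cong₂ _++_ (reverse-++ (letterPlus j 0ℤ) rest)
         (trans (reverse-concatMap (letterPlus j) (reverse-letterPlus j) (reverse positive))
           (trans (cong (concatMap (letterPlus j)) (reverse-involutive positive)) (concatMap-+ j (preorder 1 P)))) ⟩
  (reverse rest ++ reverse (letterPlus j 0ℤ)) ++ level j 1 P
    ≡⟨ cong (λ v → (reverse rest ++ v) ++ level j 1 P) (trans (reverse-letterPlus j 0ℤ) (letterPlus-+ j 0)) ⟩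
  (reverse rest ++ letter j 0) ++ level j 1 P
    ≡⟨ ++-assoc (reverse rest) _ _ ⟩
  reverse rest ++ letter j 0 ++ level j 1 P
    ≡⟨ cong₂ _++_ (reverse-sweepPlusR j ps) (level-root j P) ⟩
  code (degsAt j (leftTrees ps)) ++ code (degsAt j [ node P ])
    ≡⟨ code-++ (degsAt j (leftTrees ps)) _ ⟨
  code (degsAt j (leftTrees ps) ++ degsAt j [ node P ])
    ≡⟨ cong code (degsAt-++ j (leftTrees ps) [ node P ]) ⟨
  code (degsAt j (leftTrees ps ++ [ node P ])) ∎
  where
  open ≡-Reasoning
  positive = map +_ (preorder 1 P)
  rest     = sweepPlusR j (values ps)

minus-values : ∀ j ps → concatMap (letterMinus j) (values ps) ≡ code (degsAt j (rightTrees ps))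
minus-values zero    [] = refl
minus-values (suc j) [] = minus-values j []
minus-values j ((P , Q) ∷ ps) = begin
  concatMap (letterMinus j) (values ((P , Q) ∷ ps))
    ≡⟨ concatMap-values (letterMinus j) P Q ps ⟩
  concatMap (letterMinus j) (reverse positive) ++ letterMinus j 0ℤ ++ concatMap (letterMinus j) (map (-_ ∘ +_) (preorder 1 Q)) ++ rest
    ≡⟨ cong₂ _++_
         (trans (sym (reverse-concatMap (letterMinus j) (reverse-letterMinus j) positive))
           (cong reverse (concatMap-minus-+ j 0 P)))
         (cong₂ _++_ (trans (letterMinus-neg j 0ℤ) (letterPlus-+ j 0))
           (cong₂ _++_ (concatMap-neg j (preorder 1 Q)) (minus-values j ps))) ⟩
  letter j 0 ++ level j 1 Q ++ code (degsAt j (rightTrees ps))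
    ≡⟨ ++-assoc (letter j 0) _ _ ⟨
  (letter j 0 ++ level j 1 Q) ++ code (degsAt j (rightTrees ps))
    ≡⟨ cong (_++ code (degsAt j (rightTrees ps))) (level-root j Q) ⟩
  code (degsAt j [ node Q ]) ++ code (degsAt j (rightTrees ps))
    ≡⟨ code-++ (degsAt j [ node Q ]) _ ⟨
  code (degsAt j [ node Q ] ++ degsAt j (rightTrees ps))
    ≡⟨ cong code (degsAt-++ j [ node Q ] (rightTrees ps)) ⟨
  code (degsAt j (node Q ∷ rightTrees ps)) ∎
  where
  open ≡-Reasoning
  positive = map +_ (preorder 1 P)
  rest     = concatMap (letterMinus j) (values ps)

reverse-sweepMinusL : ∀ j ps → reverse (sweepMinusL j (values ps)) ≡ code (degsAt j (rightTrees ps))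
reverse-sweepMinusL j ps = trans (reverse-concatMap (letterMinus j) (reverse-letterMinus j) (reverse (values ps)))
  (trans (cong (concatMap (letterMinus j)) (reverse-involutive (values ps))) (minus-values j ps))

sweep : ℕ → List ℤ → List Step
sweep k a = concatMap (λ j → sweepMinusL j a ++ sweepPlusR j a) (downFrom k)

-- The sweep visits the levels from the top down, so its reversal visits them breadth first. Within
-- a level the reversal puts the rightward sweep first, which is why `forest` lists `leftTrees`
-- before `rightTrees`.
reverse-sweep : ∀ k ps → reverse (sweep k (values ps)) ≡ code (bfs k (forest ps))
reverse-sweep zero    ps = refl
reverse-sweep (suc k) ps = begin
  reverse ((SL ++ SR) ++ sweep k (values ps))
    ≡⟨ reverse-++ (SL ++ SR) _ ⟩
  reverse (sweep k (values ps)) ++ reverse (SL ++ SR)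
    ≡⟨ cong₂ _++_ (reverse-sweep k ps) (trans (reverse-++ SL SR)
         (cong₂ _++_ (reverse-sweepPlusR k ps) (reverse-sweepMinusL k ps))) ⟩
  code (bfs k (forest ps)) ++ code (degsAt k (leftTrees ps)) ++ code (degsAt k (rightTrees ps))
    ≡⟨ cong (code (bfs k (forest ps)) ++_) (trans (sym (code-++ (degsAt k (leftTrees ps)) _))
         (cong code (sym (degsAt-++ k (leftTrees ps) (rightTrees ps))))) ⟩
  code (bfs k (forest ps)) ++ code (degsAt k (forest ps))
    ≡⟨ code-++ (bfs k (forest ps)) _ ⟨
  code (bfs k (forest ps) ++ degsAt k (forest ps))
    ≡⟨ cong code (bfs-last k (forest ps)) ⟨
  code (bfs (suc k) (forest ps)) ∎
  where
  open ≡-Reasoning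
  SL = sweepMinusL k (values ps)
  SR = sweepPlusR k (values ps)

-- The sweep of the height vector is a bijection

ζ : ℕ → List Step → List Step
ζ n w = dropLast (sweepWord n (area 0ℤ w))

-- The extra initial `E` of `path` lifts the height from -1 to 0, so `area` started at `-[1+ 0 ]`
-- along `E ∷ w` is `area 0ℤ w`. The letter that `dropLast` removes is the `N` of the first root.
ζ-path : ∀ n w ps → path ps ≡ E ∷ w → ζ n w ≡ reverse (drop 1 (code (bfs (2 * n) (forest ps))))
ζ-path n w ps eq = cong (reverse ∘ drop 1) (trans
  (cong (reverse ∘ sweep (2 * n)) (trans (cong (area -[1+ 0 ]) (sym eq)) (area-path ps)))
  (reverse-sweep (2 * n) ps))

-- There are at least as many nodes as roots. The bound keeps the size of the forest within `2 * n`,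
-- so that the levels swept are enough.
length≤countN : ∀ ps → length ps ≤ countN (path ps)
length≤countN ps = +-cancelʳ-≤ (length ps) _ _ (begin
  length ps + length ps                ≡⟨ length-forest ps ⟨
  length (forest ps)                   ≤⟨ m≤n+m _ (sum (bfs (size (forest ps)) (forest ps))) ⟩
  sum (bfs (size (forest ps)) (forest ps)) + length (forest ps)
                                       ≡⟨ sum-bfs _ (forest ps) ≤-refl ⟩
  size (forest ps)                     ≡⟨ size-forest ps ⟩
  countN (path ps) + length ps         ∎)
  where open ≤-Reasoning

-- With z heights equal to 0, the forest has n + z nodes and 2z roots, hence n - z nodes that are
-- children. These are the numbers of `N`s and `E`s in the full sweep word.
record Decomposition (n : ℕ) (w : List Step) : Set where
  field
    parts     : List (Forest × Forest)
    path-eq   : path parts ≡ E ∷ w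
    size-eq   : size (forest parts) ≡ n + length parts
    size-≤    : size (forest parts) ≤ 2 * n
    deg       : ℕ
    degrees   : List ℕ
    bfs-eq    : bfs (2 * n) (forest parts) ≡ deg ∷ degrees
    ζ-eq      : ζ n w ≡ reverse (unrun (deg , degrees))
    length-eq : suc (length degrees) ≡ n + length parts
    sum-eq    : deg + sum degrees + length parts ≡ n

decompose : ∀ n w → InL (suc n) w → Decomposition (suc n) w
decompose n w (cN , cE) with path-surjective w (trans cN (cong suc (sym cE)))
... | p , ps , eq = go (bfs (2 * suc n) (forest (p ∷ ps))) refl
  where
  z = suc (length ps)
  size-eq : size (forest (p ∷ ps)) ≡ suc n + z
  size-eq = trans (size-forest (p ∷ ps)) (cong (_+ z) (trans (cong countN eq) cN))
  size-≤ : size (forest (p ∷ ps)) ≤ 2 * suc n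
  size-≤ = ≤-trans (≤-reflexive size-eq) (+-monoʳ-≤ (suc n)
    (≤-trans (length≤countN (p ∷ ps)) (≤-reflexive (trans (trans (cong countN eq) cN) (sym (+-identityʳ (suc n)))))))
  go : ∀ ks → bfs (2 * suc n) (forest (p ∷ ps)) ≡ ks → Decomposition (suc n) w
  go [] e with () ← trans (trans (sym size-eq) (sym (length-bfs _ (forest (p ∷ ps)) size-≤))) (cong length e)
  go (k ∷ ks) e = record
    { parts = p ∷ ps ; path-eq = eq ; size-eq = size-eq ; size-≤ = size-≤ ; deg = k ; degrees = ks ; bfs-eq = e
    ; ζ-eq = trans (ζ-path (suc n) w (p ∷ ps) eq) (cong (reverse ∘ drop 1 ∘ code) e)
    ; length-eq = trans (sym (cong length e)) (trans (length-bfs _ _ size-≤) size-eq)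
    ; sum-eq = +-cancelʳ-≡ z _ _ (begin
        k + sum ks + z + z                              ≡⟨ +-assoc (k + sum ks) z z ⟩
        k + sum ks + (z + z)                            ≡⟨ cong₂ _+_ (cong sum e) (length-forest (p ∷ ps)) ⟨
        sum (bfs (2 * suc n) (forest (p ∷ ps))) + length (forest (p ∷ ps))  ≡⟨ sum-bfs _ _ size-≤ ⟩
        size (forest (p ∷ ps))                          ≡⟨ size-eq ⟩
        suc n + z                                       ∎)
    }
    where open ≡-Reasoning

length-unrun : ∀ k ks → length (unrun (k , ks)) ≡ length ks + (k + sum ks)
length-unrun k ks = trans (length≡countN+countE (unrun (k , ks))) (cong₂ _+_ (countN-run k ks) (countE-run k ks))

ζ-ballot : ∀ n w → InL (suc n) w → InB (suc n) (ζ (suc n) w)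
ζ-ballot n w l = subst (InB (suc n)) (sym ζ-eq)
  ( trans (length-reverse (unrun (deg , degrees))) (trans (length-unrun deg degrees) (cong (_∸ 1) total))
  , suffixBallot⇒prefixBallot (unrun (deg , degrees)) (runBallot⇒suffixBallot deg degrees
      (subst RunBallot bfs-eq (runBallot-bfs (2 * suc n) (forest parts) size-≤))))
  where
  open Decomposition (decompose n w l)
  rearrange : ∀ a b c → a + c + b ≡ a + (b + c)
  rearrange = solve-∀
  total : suc (length degrees) + (deg + sum degrees) ≡ 2 * suc n
  total = begin
    suc (length degrees) + (deg + sum degrees)           ≡⟨ cong (_+ (deg + sum degrees)) length-eq ⟩
    suc n + length parts + (deg + sum degrees)           ≡⟨ rearrange (suc n) (deg + sum degrees) (length parts) ⟩
    suc n + (deg + sum degrees + length parts)           ≡⟨ cong (λ s → suc n + s) (trans sum-eq (sym (+-identityʳ (suc n)))) ⟩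
    2 * suc n                                            ∎
    where open ≡-Reasoning

-- The number of letters `N` in the image determines the number of zero heights, hence the number of
-- roots that `bfs-injective` and `forest-injective` ask for.
ζ-injective : ∀ n v w → InL (suc n) v → InL (suc n) w → ζ (suc n) v ≡ ζ (suc n) w → v ≡ w
ζ-injective n v w lv lw eq = ∷-injectiveʳ (trans (sym V.path-eq) (trans (cong path parts-eq) W.path-eq))
  where
  module V = Decomposition (decompose n v lv)
  module W = Decomposition (decompose n w lw)
  degrees-eq : (V.deg ≡ W.deg) × (V.degrees ≡ W.degrees)
  degrees-eq = unrun-injective V.deg V.degrees W.deg W.degrees
    (reverse-injective (trans (sym V.ζ-eq) (trans eq W.ζ-eq)))
  length-eq : length V.parts ≡ length W.parts
  length-eq = +-cancelˡ-≡ (suc n) _ _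
    (trans (sym V.length-eq) (trans (cong (suc ∘ length) (proj₂ degrees-eq)) W.length-eq))
  parts-eq : V.parts ≡ W.parts
  parts-eq = forest-injective V.parts W.parts length-eq
    (bfs-injective (2 * suc n) (forest V.parts) (forest W.parts) V.size-≤ W.size-≤
      (trans (length-forest V.parts) (trans (cong₂ _+_ length-eq length-eq) (sym (length-forest W.parts))))
      (trans V.bfs-eq (trans (cong₂ _∷_ (proj₁ degrees-eq) (proj₂ degrees-eq)) (sym W.bfs-eq))))

ζ-surjective : ∀ n b → InB (suc n) b → ∃ λ w → InL (suc n) w × (ζ (suc n) w ≡ b)
ζ-surjective n b (len , ballot) = construct (proj₁ P) (proj₁ (proj₂ P)) (proj₂ (proj₂ P))
  where
  k  = proj₁ (runs (reverse b))
  ks = proj₂ (runs (reverse b))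
  runs-eq : unrun (k , ks) ≡ reverse b
  runs-eq = unrun-runs (reverse b)
  rb : RunBallot (k ∷ ks)
  rb = suffixBallot⇒runBallot k ks (subst SuffixBallot (sym runs-eq) (prefixBallot⇒suffixBallot b ballot))
  total : length ks + (k + sum ks) ≡ n + suc n
  total = trans (sym (length-unrun k ks)) (trans (cong length runs-eq) (trans (length-reverse b)
    (trans len (cong (λ s → n + s) (+-identityʳ (suc n))))))
  sum≤n : k + sum ks ≤ n
  sum≤n with ≤-<-connex (k + sum ks) n
  ... | inj₁ p = p
  ... | inj₂ q with () ← <-irrefl (sym total) (+-mono-<-≤ (≤-trans q (proj₁ rb)) q)
  -- An image has suc n - z letters `E`, which forces this value; `length-ks` then says that exactly
  -- 2z nodes are left as roots.
  z = suc n ∸ (k + sum ks)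
  sum+z : k + sum ks + z ≡ suc n
  sum+z = m+[n∸m]≡n (m≤n⇒m≤1+n sum≤n)
  length-ks : suc (length ks) ≡ k + sum ks + (z + z)
  length-ks = +-cancelʳ-≡ (k + sum ks) _ _ (begin
    suc (length ks) + (k + sum ks)              ≡⟨ cong suc total ⟩
    suc n + suc n                               ≡⟨ cong₂ _+_ sum+z sum+z ⟨
    k + sum ks + z + (k + sum ks + z)           ≡⟨ rearrange (k + sum ks) z ⟩
    k + sum ks + (z + z) + (k + sum ks)         ∎)
    where
    open ≡-Reasoning
    rearrange : ∀ s z → s + z + (s + z) ≡ s + (z + z) + s
    rearrange = solve-∀
  length≤ : suc (length ks) ≤ 2 * suc n
  length≤ = ≤-trans (m≤m+n (suc (length ks)) (k + sum ks))
    (≤-reflexive (cong suc (trans total (cong (λ s → n + s) (sym (+-identityʳ (suc n)))))))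
  F = bfs-surjective (2 * suc n) (z + z) (k ∷ ks) rb length-ks length≤
  P : ∃ λ ps → (length ps ≡ z) × (forest ps ≡ proj₁ F)
  P = forest-surjective z (proj₁ F) (proj₁ (proj₂ F))
  construct : ∀ ps → length ps ≡ z → forest ps ≡ proj₁ F → ∃ λ w → InL (suc n) w × (ζ (suc n) w ≡ b)
  -- By `sum≤n` the number z is positive, so the path begins with an `E` that can be stripped off.
  construct [] l _ with () ← <-irrefl l (m<n⇒0<n∸m (s≤s sum≤n))
  construct ((R , S) ∷ ps) l e = w , (countN-w , suc-injective (trans (sym (path-balanced qs)) countN-w)) , ζ-w
    where
    qs = (R , S) ∷ ps
    w = hills R ++ N ∷ valleys S ++ path ps
    bfs-eq : bfs (2 * suc n) (forest qs) ≡ k ∷ ks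
    bfs-eq = trans (cong (bfs (2 * suc n)) e) (proj₂ (proj₂ (proj₂ F)))
    ζ-w : ζ (suc n) w ≡ b
    ζ-w = trans (ζ-path (suc n) w qs refl) (trans (cong (reverse ∘ drop 1 ∘ code) bfs-eq)
      (trans (cong reverse runs-eq) (reverse-involutive b)))
    countN-w : countN w ≡ suc n
    countN-w = +-cancelʳ-≡ (length qs) _ _ (begin
      countN w + length qs         ≡⟨ size-forest qs ⟨
      size (forest qs)             ≡⟨ trans (cong size e) (trans (proj₁ (proj₂ (proj₂ F))) length-ks) ⟩
      k + sum ks + (z + z)         ≡⟨ +-assoc (k + sum ks) z z ⟨
      k + sum ks + z + z           ≡⟨ cong₂ _+_ sum+z (sym l) ⟩
      suc n + length qs            ∎)
      where open ≡-Reasoning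

-- Symmetries of the sweep word, and μ

infix 4 _≈ᵢ_

-- Equality up to the last letter. The quantifier over `p` keeps the relation stable under prefixes
-- even for empty words, where `dropLast` would reach into the prefix.
_≈ᵢ_ : List Step → List Step → Set
u ≈ᵢ v = ∀ p → dropLast (p ++ u) ≡ dropLast (p ++ v)

≈ᵢ-prefix : ∀ p {u v} → u ≈ᵢ v → p ++ u ≈ᵢ p ++ v
≈ᵢ-prefix p {u} {v} h q = subst₂ (λ s t → dropLast s ≡ dropLast t) (++-assoc q p u) (++-assoc q p v) (h (q ++ p))

dropLast-∷ʳ : ∀ u x → dropLast (u ∷ʳ x) ≡ u
dropLast-∷ʳ u x = trans (cong (reverse ∘ drop 1) (reverse-++ u [ x ])) (reverse-involutive u)

letter-< : ∀ {j d} → d < j → letter j d ≡ []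
letter-< {suc j} {zero}  _       = refl
letter-< {suc j} {suc d} (s≤s p) = letter-< p

letterPlus-suc-neg : ∀ j d → letterPlus (suc j) (- + d) ≡ []
letterPlus-suc-neg j zero    = refl
letterPlus-suc-neg j (suc d) = refl

block : ℕ → List ℤ → List Step
block j a = sweepMinusL j a ++ sweepPlusR j a

block-∷ : ∀ j x a → block j (x ∷ a) ≡ sweepMinusL j a ++ (letterMinus j x ++ letterPlus j x) ++ sweepPlusR j a
block-∷ j x a = begin
  sweepMinusL j (x ∷ a) ++ sweepPlusR j (x ∷ a)
    ≡⟨ cong (λ r → concatMap (letterMinus j) r ++ sweepPlusR j (x ∷ a)) (unfold-reverse x a) ⟩
  concatMap (letterMinus j) (reverse a ∷ʳ x) ++ sweepPlusR j (x ∷ a)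
    ≡⟨ cong (_++ sweepPlusR j (x ∷ a)) (concatMap-++ (letterMinus j) (reverse a) [ x ]) ⟩
  (sweepMinusL j a ++ letterMinus j x ++ []) ++ letterPlus j x ++ sweepPlusR j a
    ≡⟨ cong (λ s → (sweepMinusL j a ++ s) ++ letterPlus j x ++ sweepPlusR j a) (++-identityʳ (letterMinus j x)) ⟩
  (sweepMinusL j a ++ letterMinus j x) ++ letterPlus j x ++ sweepPlusR j a
    ≡⟨ ++-assoc (sweepMinusL j a) _ _ ⟩
  sweepMinusL j a ++ letterMinus j x ++ letterPlus j x ++ sweepPlusR j a
    ≡⟨ cong (sweepMinusL j a ++_) (++-assoc (letterMinus j x) _ _) ⟨
  sweepMinusL j a ++ (letterMinus j x ++ letterPlus j x) ++ sweepPlusR j a ∎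
  where open ≡-Reasoning

letters-neg : ∀ j d → letterMinus j (- + d) ++ letterPlus j (- + d) ≡ letterMinus j (+ d) ++ letterPlus j (+ d)
letters-neg j zero    = refl
letters-neg j (suc d) rewrite letterMinus-neg j (+ suc d) | letterPlus-neg j d | letterMinus-+ j d = ++-identityʳ _

-- At each level the first entry is read last by the leftward sweep and first by the rightward
-- sweep. Its letters are thus adjacent, and a change of sign only moves a letter from one sweep to
-- the other.
sweep-neg-head : ∀ k d a → sweep k (- + d ∷ a) ≡ sweep k (+ d ∷ a)
sweep-neg-head k d a = concatMap-cong
  (λ j → trans (block-∷ j (- + d) a)
    (trans (cong (λ s → sweepMinusL j a ++ s ++ sweepPlusR j a) (letters-neg j d)) (sym (block-∷ j (+ d) a))))
  (downFrom k)

block-∷ʳ : ∀ j a x → block j (a ∷ʳ x) ≡ letterMinus j x ++ block j a ++ letterPlus j x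
block-∷ʳ j a x = begin
  sweepMinusL j (a ∷ʳ x) ++ sweepPlusR j (a ∷ʳ x)
    ≡⟨ cong₂ (λ r s → concatMap (letterMinus j) r ++ s) (reverse-++ a [ x ]) (concatMap-++ (letterPlus j) a [ x ]) ⟩
  (letterMinus j x ++ sweepMinusL j a) ++ sweepPlusR j a ++ letterPlus j x ++ []
    ≡⟨ cong (λ s → (letterMinus j x ++ sweepMinusL j a) ++ sweepPlusR j a ++ s) (++-identityʳ (letterPlus j x)) ⟩
  (letterMinus j x ++ sweepMinusL j a) ++ sweepPlusR j a ++ letterPlus j x
    ≡⟨ ++-assoc (letterMinus j x) _ _ ⟩
  letterMinus j x ++ sweepMinusL j a ++ sweepPlusR j a ++ letterPlus j x
    ≡⟨ cong (letterMinus j x ++_) (++-assoc (sweepMinusL j a) _ _) ⟨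
  letterMinus j x ++ block j a ++ letterPlus j x ∎
  where open ≡-Reasoning

-- The last entry contributes the adjacent last letter of the rightward sweep at level j + 1 and first letter of
-- the leftward sweep at level j, which the entries l + 1 and − l exchange.
seam-last : ∀ j l → letterPlus (suc j) (+ suc l) ++ letterMinus j (+ suc l) ≡
  letterPlus (suc j) (- + l) ++ letterMinus j (- + l)
seam-last j l rewrite letterMinus-+ j l | letterPlus-suc-neg j l | letterMinus-neg j (+ l)
  | letterPlus-+ (suc j) (suc l) = ++-identityʳ (letter j l)

sweep-suc-last : ∀ j a x → letterPlus (suc j) x ++ sweep (suc j) (a ∷ʳ x) ≡
  (letterPlus (suc j) x ++ letterMinus j x) ++ block j a ++ letterPlus j x ++ sweep j (a ∷ʳ x)
sweep-suc-last j a x = begin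
  letterPlus (suc j) x ++ block j (a ∷ʳ x) ++ sweep j (a ∷ʳ x)
    ≡⟨ cong (λ s → letterPlus (suc j) x ++ s ++ sweep j (a ∷ʳ x)) (block-∷ʳ j a x) ⟩
  letterPlus (suc j) x ++ (letterMinus j x ++ block j a ++ letterPlus j x) ++ sweep j (a ∷ʳ x)
    ≡⟨ cong (letterPlus (suc j) x ++_) (trans (++-assoc (letterMinus j x) _ _)
         (cong (letterMinus j x ++_) (++-assoc (block j a) _ _))) ⟩
  letterPlus (suc j) x ++ letterMinus j x ++ block j a ++ letterPlus j x ++ sweep j (a ∷ʳ x)
    ≡⟨ ++-assoc (letterPlus (suc j) x) _ _ ⟨
  (letterPlus (suc j) x ++ letterMinus j x) ++ block j a ++ letterPlus j x ++ sweep j (a ∷ʳ x) ∎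
  where open ≡-Reasoning

-- The letter in front is the one that the last entry left at the end of the rightward sweep one
-- level up; carrying it along makes every seam between consecutive levels complete.
sweep-reflect-last-≈ : ∀ j a l →
  letterPlus j (+ suc l) ++ sweep j (a ∷ʳ + suc l) ≈ᵢ letterPlus j (- + l) ++ sweep j (a ∷ʳ - + l)
-- The entries 1 and 0 leave `E` and `N` as the very last letter of the word, the one that
-- `dropLast` removes.
sweep-reflect-last-≈ zero    a zero    p = trans (dropLast-∷ʳ p E) (sym (dropLast-∷ʳ p N))
sweep-reflect-last-≈ zero    a (suc l) p = refl
sweep-reflect-last-≈ (suc j) a l = subst₂ _≈ᵢ_ (sym (sweep-suc-last j a (+ suc l)))
  (trans (cong (_++ block j a ++ letterPlus j (- + l) ++ sweep j (a ∷ʳ - + l)) (seam-last j l))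
    (sym (sweep-suc-last j a (- + l))))
  (≈ᵢ-prefix (letterPlus (suc j) (+ suc l) ++ letterMinus j (+ suc l)) (≈ᵢ-prefix (block j a) (sweep-reflect-last-≈ j a l)))

-- Above the highest level swept the carried letter is empty, by `suc l < k` for the entry
-- `+ suc l`.
sweep-reflect-last : ∀ k a l → suc l < k → dropLast (sweep k (a ∷ʳ + suc l)) ≡ dropLast (sweep k (a ∷ʳ - + l))
sweep-reflect-last (suc k) a l p = subst₂
  (λ s t → dropLast (s ++ sweep (suc k) (a ∷ʳ + suc l)) ≡ dropLast (t ++ sweep (suc k) (a ∷ʳ - + l)))
  (trans (letterPlus-+ (suc k) (suc l)) (letter-< p)) (letterPlus-suc-neg k l) (sweep-reflect-last-≈ (suc k) a l [])

-- In closed form, (k , l) goes to (2k , l - k) if k ≤ l and to (2l + 1 , k - l - 1) otherwise; the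
-- parity of the first component tells the two cases apart.
θ : ℕ × ℕ → ℕ × ℕ
θ (zero  , l)     = zero , l
θ (suc k , zero)  = 1 , k
θ (suc k , suc l) = let k′ , l′ = θ (k , l) in suc (suc k′) , l′

θ⁻¹ : ℕ × ℕ → ℕ × ℕ
θ⁻¹ (zero        , l) = zero , l
θ⁻¹ (suc zero    , l) = suc l , zero
θ⁻¹ (suc (suc k) , l) = let k′ , l′ = θ⁻¹ (k , l) in suc k′ , suc l′

θ⁻¹-θ : ∀ k l → θ⁻¹ (θ (k , l)) ≡ (k , l)
θ⁻¹-θ zero    l       = refl
θ⁻¹-θ (suc k) zero    = refl
θ⁻¹-θ (suc k) (suc l) rewrite θ⁻¹-θ k l = refl

θ-θ⁻¹ : ∀ k l → θ (θ⁻¹ (k , l)) ≡ (k , l)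
θ-θ⁻¹ zero          l = refl
θ-θ⁻¹ (suc zero)    l = refl
θ-θ⁻¹ (suc (suc k)) l rewrite θ-θ⁻¹ k l = refl

θ-sum : ∀ k l → proj₁ (θ (k , l)) + proj₂ (θ (k , l)) ≡ k + l
θ-sum zero    l       = refl
θ-sum (suc k) zero    = cong suc (sym (+-identityʳ k))
θ-sum (suc k) (suc l) = trans (cong (suc ∘ suc) (θ-sum k l)) (cong suc (sym (+-suc k l)))

-- Exactly one of x and 1 - x is nonpositive. For x = k - l, the second component of `θ` is its
-- absolute value.
θ-difference : ∀ k l → (k ⊖ l ≡ - + proj₂ (θ (k , l))) ⊎ (k ⊖ l ≡ + suc (proj₂ (θ (k , l))))
θ-difference zero    zero    = inj₁ refl
θ-difference zero    (suc l) = inj₁ refl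
θ-difference (suc k) zero    = inj₂ refl
θ-difference (suc k) (suc l) rewrite ℤ.[1+m]⊖[1+n]≡m⊖n k l = θ-difference k l

-- Partial sums of run lengths, and the entries of μ

psums : ℕ → List ℕ → List ℕ
psums c []       = []
psums c (k ∷ ks) = c ∷ psums (c + k) ks

psums-++ : ∀ c ks ls → psums c (ks ++ ls) ≡ psums c ks ++ psums (c + sum ks) ls
psums-++ c []       ls = cong (λ d → psums d ls) (sym (+-identityʳ c))
psums-++ c (k ∷ ks) ls = cong (c ∷_) (trans (psums-++ (c + k) ks ls)
  (cong (λ d → psums (c + k) ks ++ psums d ls) (+-assoc c k (sum ks))))

length-psums : ∀ c ks → length (psums c ks) ≡ length ks
length-psums c []       = refl
length-psums c (k ∷ ks) = cong suc (length-psums (c + k) ks)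

eastBefore-unrun : ∀ c k ks → eastBefore c (unrun (k , ks)) ≡ psums (c + k) ks
eastBefore-unrun c zero    []       = refl
eastBefore-unrun c zero    (l ∷ ks) rewrite +-identityʳ c = cong (c ∷_) (eastBefore-unrun c l ks)
eastBefore-unrun c (suc k) ks       = trans (eastBefore-unrun (suc c) k ks) (cong (λ d → psums d ks) (sym (+-suc c k)))

length-psums-∷ʳ : ∀ c ks s → length (psums c ks ∷ʳ s) ≡ suc (length ks)
length-psums-∷ʳ c ks s = trans (length-++ (psums c ks)) (trans (+-comm _ 1) (cong suc (length-psums c ks)))

area-shiftFrom : ∀ c i w → area (+ c ℤ.- + i) w ≡ shiftFrom i (map +_ (eastBefore c w))
area-shiftFrom c i []      = refl
area-shiftFrom c i (N ∷ w) = cong (+ c ℤ.- + i ∷_)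
  (trans (cong (λ h → area h w) (rearrange (+ c) (+ i))) (area-shiftFrom c (suc i) w))
  where
  rearrange : ∀ c i → - 1ℤ ℤ.+ (c ℤ.+ - i) ≡ c ℤ.+ - (1ℤ ℤ.+ i)
  rearrange = ℤ-Solver.solve-∀
area-shiftFrom c i (E ∷ w) = trans (cong (λ h → area h w) (rearrange (+ c) (+ i))) (area-shiftFrom (suc c) i w)
  where
  rearrange : ∀ c i → 1ℤ ℤ.+ (c ℤ.+ - i) ≡ 1ℤ ℤ.+ c ℤ.+ - i
  rearrange = ℤ-Solver.solve-∀

shiftFrom-++ : ∀ i xs ys → shiftFrom i (xs ++ ys) ≡ shiftFrom i xs ++ shiftFrom (i + length xs) ys
shiftFrom-++ i []       ys = cong (λ j → shiftFrom j ys) (sym (+-identityʳ i))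
shiftFrom-++ i (x ∷ xs) ys = cong (x ℤ.- + i ∷_) (trans (shiftFrom-++ (suc i) xs ys)
  (cong (λ j → shiftFrom (suc i) xs ++ shiftFrom j ys) (sym (+-suc i (length xs)))))

at-length : ∀ xs y ys → at (xs ++ y ∷ ys) (suc (length xs)) ≡ y
at-length []           y ys = refl
at-length (x ∷ [])     y ys = refl
at-length (x ∷ z ∷ xs) y ys = at-length (z ∷ xs) y ys

-- Since n - λₙ = 1 - (λₙ - (n - 1)), the residue of n - 1 modulo 4 only selects a sign for the
-- first entry and a reflection y ↦ 1 - y for the last, the two symmetries of the truncated sweep
-- word.
mu-shape : ∀ n π → ∃₂ λ x y → (mu n π ≡ x ∷ (shiftFrom 1 (lamMid n π) ++ [ y ]))
  × ((x ≡ lam1 n π) ⊎ (x ≡ - lam1 n π)) × ((y ≡ lamN n π ℤ.- + (n ∸ 1)) ⊎ (y ≡ + n ℤ.- lamN n π))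
mu-shape n π with (n ∸ 1) % 4
... | 0 = _ , _ , refl , inj₁ refl , inj₁ refl
... | 1 = _ , _ , refl , inj₂ refl , inj₂ refl
... | 2 = _ , _ , refl , inj₂ refl , inj₂ refl
... | 3 = _ , _ , refl , inj₁ refl , inj₁ refl
... | suc (suc (suc (suc _))) = _ , _ , refl , inj₂ refl , inj₂ refl

star-plain : ∀ w → star (map plain w) ≡ w
star-plain []      = refl
star-plain (N ∷ w) = cong (N ∷_) (star-plain w)
star-plain (E ∷ w) = cong (E ∷_) (star-plain w)

star-mark : ∀ k s w → forget s ≡ E → star (mark k s w) ≡ w
star-mark k             s []          h = refl
star-mark zero          s (E ∷ w)     h = cong (E ∷_) (star-mark zero s w h)
star-mark (suc zero)    s (E ∷ w)     h = cong (E ∷_) (star-mark 1 s w h)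
star-mark (suc (suc k)) s (E ∷ w)     h = cong (E ∷_) (star-mark (suc (suc k)) s w h)
star-mark zero          s (N ∷ w)     h = cong (N ∷_) (star-plain w)
star-mark (suc zero)    s (N ∷ [])    h = refl
star-mark (suc zero)    s (N ∷ N ∷ w) h = cong (λ v → N ∷ N ∷ v) (star-plain w)
star-mark (suc zero)    s (N ∷ E ∷ w) h = cong (N ∷_) (cong₂ _∷_ h (star-plain w))
star-mark (suc (suc k)) s (N ∷ w)     h = cong (N ∷_) (star-mark (suc k) s w h)

star-zetaD : ∀ n π → star (zetaD n π) ≡ dropLast (sweepWord n (mu n π))
star-zetaD n π with isEven (countPos (mu n π))
... | true  = star-mark n sE⁺ _ refl
... | false = star-mark n sE⁻ _ refl

-- As n - 1 = s + k + l, the number λₙ - (n - 1) is k - l in the even case and 1 - (k - l) in the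
-- odd case; n - λₙ is the other of the two.
lamN-cases : ∀ n π s k l → p n π (n ∸ 1) ≡ s → p n π n ≡ s + k → n ≡ suc (s + k + l) →
  ∀ {y} → (y ≡ lamN n π ℤ.- + (n ∸ 1)) ⊎ (y ≡ + n ℤ.- lamN n π) → (y ≡ k ⊖ l) ⊎ (y ≡ 1ℤ ℤ.- (k ⊖ l))
lamN-cases n π s k l ps≡ pn≡ refl h rewrite ps≡ | pn≡ | sym (ℤ.m-n≡m⊖n k l) =
  go (isEven (sum (take (n ∸ 2) (ps n π)))) h
  where
  go : ∀ b {y} →
    let λₙ = if b then (+ (2 * (s + k))) ℤ.- + s else (+ (2 * n ∸ 1)) ℤ.- (+ (2 * (s + k))) ℤ.+ + s in
    (y ≡ λₙ ℤ.- + (s + k + l)) ⊎ (y ≡ + n ℤ.- λₙ) → (y ≡ + k ℤ.- + l) ⊎ (y ≡ 1ℤ ℤ.- (+ k ℤ.- + l))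
  go true  (inj₁ e) = inj₁ (trans e (ring (+ s) (+ k) (+ l)))
    where
    ring : ∀ s k l → (s ℤ.+ k ℤ.+ (s ℤ.+ k ℤ.+ 0ℤ)) ℤ.+ - s ℤ.+ - (s ℤ.+ k ℤ.+ l) ≡ k ℤ.+ - l
    ring = ℤ-Solver.solve-∀
  go true  (inj₂ e) = inj₂ (trans e (ring (+ s) (+ k) (+ l)))
    where
    ring : ∀ s k l →
      1ℤ ℤ.+ (s ℤ.+ k ℤ.+ l) ℤ.+ - ((s ℤ.+ k ℤ.+ (s ℤ.+ k ℤ.+ 0ℤ)) ℤ.+ - s) ≡ 1ℤ ℤ.+ - (k ℤ.+ - l)
    ring = ℤ-Solver.solve-∀
  go false (inj₁ e) = inj₂ (trans e (ring (+ s) (+ k) (+ l)))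
    where
    ring : ∀ s k l →
      ((s ℤ.+ k ℤ.+ l) ℤ.+ (1ℤ ℤ.+ (s ℤ.+ k ℤ.+ l ℤ.+ 0ℤ)))
        ℤ.+ - (s ℤ.+ k ℤ.+ (s ℤ.+ k ℤ.+ 0ℤ)) ℤ.+ s ℤ.+ - (s ℤ.+ k ℤ.+ l) ≡ 1ℤ ℤ.+ - (k ℤ.+ - l)
    ring = ℤ-Solver.solve-∀
  go false (inj₂ e) = inj₁ (trans e (ring (+ s) (+ k) (+ l)))
    where
    ring : ∀ s k l →
      1ℤ ℤ.+ (s ℤ.+ k ℤ.+ l) ℤ.+ - (((s ℤ.+ k ℤ.+ l) ℤ.+ (1ℤ ℤ.+ (s ℤ.+ k ℤ.+ l ℤ.+ 0ℤ)))
        ℤ.+ - (s ℤ.+ k ℤ.+ (s ℤ.+ k ℤ.+ 0ℤ)) ℤ.+ s) ≡ k ℤ.+ - l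
    ring = ℤ-Solver.solve-∀

-- Reduction of ζ_D to ζ by changing the last two runs

withTail : ℕ → List ℕ → ℕ × ℕ → List Step
withTail e ms (k , l) = unrun (e , ms ++ k ∷ l ∷ [])

countN-withTail : ∀ e ms kl → countN (withTail e ms kl) ≡ length ms + 2
countN-withTail e ms (k , l) = trans (countN-run e _) (length-++ ms)

countE-withTail : ∀ e ms kl → countE (withTail e ms kl) ≡ e + sum ms + (proj₁ kl + proj₂ kl)
countE-withTail e ms (k , l) = trans (countE-run e _) (trans (cong (λ s → e + s) (sum-++ ms (k ∷ l ∷ [])))
  (rearrange e (sum ms) k l))
  where
  rearrange : ∀ e m k l → e + (m + (k + (l + 0))) ≡ e + m + (k + l)
  rearrange = solve-∀

withTail-InL : ∀ n e ms kl kl′ → proj₁ kl + proj₂ kl ≡ proj₁ kl′ + proj₂ kl′ →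
  InL n (withTail e ms kl) → InL n (withTail e ms kl′)
withTail-InL n e ms kl kl′ eq (cN , cE) =
  trans (countN-withTail e ms kl′) (trans (sym (countN-withTail e ms kl)) cN) ,
  trans (countE-withTail e ms kl′) (trans (cong (λ s → e + sum ms + s) (sym eq))
    (trans (sym (countE-withTail e ms kl)) cE))

split-last-two : ∀ r (ks : List ℕ) → length ks ≡ suc (suc r) →
  ∃₂ λ ms kl → (length ms ≡ r) × (ks ≡ ms ++ proj₁ kl ∷ proj₂ kl ∷ [])
split-last-two zero    (k ∷ l ∷ [])    _ = [] , (k , l) , refl , refl
split-last-two (suc r) (m ∷ ks)        p with split-last-two r ks (suc-injective p)
... | ms , kl , len , refl = m ∷ ms , kl , cong suc len , refl
split-last-two zero    []              ()
split-last-two zero    (_ ∷ [])        ()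
split-last-two zero    (_ ∷ _ ∷ _ ∷ _) ()
split-last-two (suc r) []              ()

-- The bound `3 ≤ n` provides the run `m` besides the last two, which separates the first height
-- from the one at position n - 1.
split-tail : ∀ n w → 3 ≤ n → InL n w → ∃₂ λ e m → ∃₂ λ ms kl → w ≡ withTail e (m ∷ ms) kl
split-tail (suc (suc (suc r))) w (s≤s (s≤s (s≤s z≤n))) (cN , _) with runs w | unrun-runs w
... | e , ks | eq
  with split-last-two (suc r) ks (trans (sym (countN-run e ks)) (trans (cong countN eq) cN))
... | []     , kl , () , _
... | m ∷ ms , kl , _ , refl = e , m , ms , kl , sym eq

withTail-injective : ∀ e ms kl e′ ms′ kl′ → withTail e ms kl ≡ withTail e′ ms′ kl′ →
  (e ≡ e′) × (ms ≡ ms′) × (kl ≡ kl′)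
withTail-injective e ms (k , l) e′ ms′ (k′ , l′) eq with unrun-injective e _ e′ _ eq
... | refl , eq₁ with ∷ʳ-injective (ms ∷ʳ k) (ms′ ∷ʳ k′) (trans (++-assoc ms _ _) (trans eq₁ (sym (++-assoc ms′ _ _))))
... | eq₂ , refl with ∷ʳ-injective ms ms′ eq₂
... | refl , refl = refl , refl , refl

θ-injective : ∀ kl kl′ → θ kl ≡ θ kl′ → kl ≡ kl′
θ-injective (k , l) (k′ , l′) eq = trans (sym (θ⁻¹-θ k l)) (trans (cong θ⁻¹ eq) (θ⁻¹-θ k′ l′))

eastBefore-withTail : ∀ e m ms k l → let s = e + m + sum ms in
  eastBefore 0 (withTail e (m ∷ ms) (k , l)) ≡ e ∷ (psums (e + m) ms ∷ʳ s) ++ [ s + k ]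
eastBefore-withTail e m ms k l = trans (eastBefore-unrun 0 e _) (cong (e ∷_)
  (trans (psums-++ (e + m) ms (k ∷ l ∷ [])) (sym (++-assoc (psums (e + m) ms) _ _))))

-- By the hypothesis the path ends at height -1, and `l` East steps follow its last North step,
-- which therefore starts at height - l. The other entries depend on `e`, `m` and `ms` only, so
-- applying `θ` to the last two runs changes at most the last entry.
area-withTail : ∀ e m ms k l → let s = e + m + sum ms in suc (suc (length ms)) ≡ s + (k + l) →
  area 0ℤ (withTail e (m ∷ ms) (k , l)) ≡ + e ∷ shiftFrom 1 (map +_ (psums (e + m) ms ∷ʳ s)) ++ [ - + l ]
area-withTail e m ms k l h = begin
  area 0ℤ (withTail e (m ∷ ms) (k , l))
    ≡⟨ area-shiftFrom 0 0 (withTail e (m ∷ ms) (k , l)) ⟩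
  shiftFrom 0 (map +_ (eastBefore 0 (withTail e (m ∷ ms) (k , l))))
    ≡⟨ cong (λ ks → shiftFrom 0 (map +_ ks)) (eastBefore-withTail e m ms k l) ⟩
  (+ e ℤ.- 0ℤ) ∷ shiftFrom 1 (map +_ (q ++ [ s + k ]))
    ≡⟨ cong₂ _∷_ (ℤ.+-identityʳ (+ e)) (cong (shiftFrom 1) (map-++ +_ q [ s + k ])) ⟩
  + e ∷ shiftFrom 1 (map +_ q ++ [ + (s + k) ])
    ≡⟨ cong (+ e ∷_) (shiftFrom-++ 1 (map +_ q) [ + (s + k) ]) ⟩
  + e ∷ shiftFrom 1 (map +_ q) ++ [ + (s + k) ℤ.- + suc (length (map +_ q)) ]
    ≡⟨ cong (λ i → + e ∷ shiftFrom 1 (map +_ q) ++ [ + (s + k) ℤ.- + suc i ]) (trans (length-map +_ q) length-q) ⟩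
  + e ∷ shiftFrom 1 (map +_ q) ++ [ + (s + k) ℤ.- + suc (suc (length ms)) ]
    ≡⟨ cong (λ i → + e ∷ shiftFrom 1 (map +_ q) ++ [ + (s + k) ℤ.- + i ]) h ⟩
  + e ∷ shiftFrom 1 (map +_ q) ++ [ + (s + k) ℤ.- + (s + (k + l)) ]
    ≡⟨ cong (λ i → + e ∷ shiftFrom 1 (map +_ q) ++ [ i ]) (ring (+ s) (+ k) (+ l)) ⟩
  + e ∷ shiftFrom 1 (map +_ q) ++ [ - + l ] ∎
  where
  open ≡-Reasoning
  s = e + m + sum ms
  q = psums (e + m) ms ∷ʳ s
  length-q = length-psums-∷ʳ (e + m) ms s
  ring : ∀ s k l → s ℤ.+ k ℤ.+ - (s ℤ.+ (k ℤ.+ l)) ≡ - l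
  ring = ℤ-Solver.solve-∀

sgn-* : ∀ π e → (sgn π ℤ.* + e ≡ + e) ⊎ (sgn π ℤ.* + e ≡ - + e)
sgn-* π e with hasMinus π
... | true  = inj₂ (ℤ.-1*i≡-i (+ e))
... | false = inj₁ (ℤ.*-identityˡ (+ e))

sweep-head : ∀ k e x a {λ₁} → (λ₁ ≡ + e) ⊎ (λ₁ ≡ - + e) → (x ≡ λ₁) ⊎ (x ≡ - λ₁) →
  sweep k (x ∷ a) ≡ sweep k (+ e ∷ a)
sweep-head k e x a (inj₁ refl) (inj₁ refl) = refl
sweep-head k e x a (inj₁ refl) (inj₂ refl) = sweep-neg-head k e a
sweep-head k e x a (inj₂ refl) (inj₁ refl) = sweep-neg-head k e a
sweep-head k e x a (inj₂ refl) (inj₂ refl) = cong (λ y → sweep k (y ∷ a)) (ℤ.neg-involutive (+ e))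

last-cases : ∀ k l {y} → (y ≡ k ⊖ l) ⊎ (y ≡ 1ℤ ℤ.- (k ⊖ l)) →
  let l′ = proj₂ (θ (k , l)) in (y ≡ - + l′) ⊎ (y ≡ + suc l′)
last-cases k l h with θ-difference k l
last-cases k l (inj₁ refl) | inj₁ d = inj₁ d
last-cases k l (inj₂ refl) | inj₁ d = inj₂ (trans (cong (λ y → 1ℤ ℤ.- y) d)
  (cong (λ y → 1ℤ ℤ.+ y) (ℤ.neg-involutive (+ proj₂ (θ (k , l))))))
last-cases k l (inj₁ refl) | inj₂ d = inj₂ d
last-cases k l (inj₂ refl) | inj₂ d = inj₁ (trans (cong (λ y → 1ℤ ℤ.- y) d) (ring (+ proj₂ (θ (k , l)))))
  where
  ring : ∀ l → 1ℤ ℤ.+ - (1ℤ ℤ.+ l) ≡ - l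
  ring = ℤ-Solver.solve-∀

zetaD-twist : ∀ n π e m ms k l → star π ≡ withTail e (m ∷ ms) (k , l) → InL n (star π) →
  star (zetaD n π) ≡ ζ n (withTail e (m ∷ ms) (θ (k , l)))
zetaD-twist n π e m ms k l eq (cN , cE) = begin
  star (zetaD n π)
    ≡⟨ star-zetaD n π ⟩
  dropLast (sweep (2 * n) (mu n π))
    ≡⟨ cong (dropLast ∘ sweep (2 * n)) (trans mu-eq (cong (λ ks → x ∷ (shiftFrom 1 (map +_ ks) ++ [ y ])) mid-eq)) ⟩
  dropLast (sweep (2 * n) (x ∷ (A ++ [ y ])))
    ≡⟨ cong dropLast (sweep-head (2 * n) e x (A ++ [ y ]) lam1-cases x-cases) ⟩
  dropLast (sweep (2 * n) (+ e ∷ (A ++ [ y ])))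
    -- The last entry is k - l or 1 - (k - l), hence - l′ or 1 + l′; `sweep-reflect-last` identifies
    -- these two.
    ≡⟨ last (last-cases k l (lamN-cases n π s k l pred-eq last-eq n-eq y-cases)) ⟩
  dropLast (sweep (2 * n) (+ e ∷ (A ++ [ - + l′ ])))
    ≡⟨ cong (dropLast ∘ sweep (2 * n)) (area-withTail e m ms k′ l′
         (trans (suc-injective (trans (sym n-length) n-eq)) (trans (+-assoc s k l) (cong (λ t → s + t) (sym (θ-sum k l)))))) ⟨
  ζ n (withTail e (m ∷ ms) (θ (k , l))) ∎
  where
  open ≡-Reasoning
  shape = mu-shape n π
  x = proj₁ shape
  y = proj₁ (proj₂ shape)
  mu-eq : mu n π ≡ x ∷ (shiftFrom 1 (lamMid n π) ++ [ y ])
  mu-eq = proj₁ (proj₂ (proj₂ shape))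
  x-cases = proj₁ (proj₂ (proj₂ (proj₂ shape)))
  y-cases = proj₂ (proj₂ (proj₂ (proj₂ shape)))
  n-length : n ≡ suc (suc (suc (length ms)))
  n-length = trans (sym cN) (trans (cong countN eq)
    (trans (countN-withTail e (m ∷ ms) (k , l)) (cong suc (+-comm (length ms) 2))))
  k′ = proj₁ (θ (k , l))
  l′ = proj₂ (θ (k , l))
  s  = e + m + sum ms
  q  = psums (e + m) ms ∷ʳ s
  A  = shiftFrom 1 (map +_ q)
  length-q = length-psums-∷ʳ (e + m) ms s
  ps-eq : ps n π ≡ e ∷ q ++ [ s + k ]
  ps-eq = trans (cong (eastBefore 0) eq) (eastBefore-withTail e m ms k l)
  n-eq : n ≡ suc (s + k + l)
  n-eq = trans n-length (cong suc (trans (trans (cong (_∸ 1) (sym n-length)) (sym cE))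
    (trans (cong countE eq) (trans (countE-withTail e (m ∷ ms) (k , l)) (rearrange e m (sum ms) k l)))))
    where
    rearrange : ∀ e m u k l → e + (m + u) + (k + l) ≡ e + m + u + k + l
    rearrange = solve-∀
  mid-eq : take (n ∸ 2) (drop 1 (ps n π)) ≡ q
  mid-eq = trans (cong₂ (λ i ks → take i (drop 1 ks)) (trans (cong (_∸ 2) n-length) (sym length-q)) ps-eq)
    (take-length-++ q [ s + k ])
  pred-eq : p n π (n ∸ 1) ≡ s
  pred-eq = trans (cong₂ at ps-eq (trans (cong (_∸ 1) n-length) (cong (suc ∘ suc) (sym (length-psums (e + m) ms)))))
    (trans (cong (λ ks → at (e ∷ ks) (suc (suc (length (psums (e + m) ms))))) (++-assoc (psums (e + m) ms) [ s ] [ s + k ]))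
      (at-length (e ∷ psums (e + m) ms) s [ s + k ]))
  last-eq : p n π n ≡ s + k
  last-eq = trans (cong₂ at ps-eq (trans n-length (cong (suc ∘ suc) (sym length-q)))) (at-length (e ∷ q) (s + k) [])
  lam1-cases : (lam1 n π ≡ + e) ⊎ (lam1 n π ≡ - + e)
  lam1-cases rewrite ps-eq = sgn-* π e
  -- The bound holds because l′ ≤ k + l ≤ n - 1.
  l′< : suc l′ < 2 * n
  l′< = ≤-trans (s≤s l′<n) (m<m+n n (≤-trans (≤-trans (s≤s z≤n) l′<n) (m≤m+n n 0)))
    where
    l′<n : l′ < n
    l′<n = ≤-trans (s≤s (≤-trans (m≤n+m l′ k′) (≤-trans (≤-reflexive (θ-sum k l)) (m≤n+m (k + l) s))))
      (≤-reflexive (trans (cong suc (sym (+-assoc s k l))) (sym n-eq)))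
  last : ∀ {y} → (y ≡ - + l′) ⊎ (y ≡ + suc l′) →
    dropLast (sweep (2 * n) (+ e ∷ (A ++ [ y ]))) ≡ dropLast (sweep (2 * n) (+ e ∷ (A ++ [ - + l′ ])))
  last (inj₁ refl) = refl
  last (inj₂ refl) = sweep-reflect-last (2 * n) (+ e ∷ A) l′ l′<

-- Signed lifts and the four parts of the bijection statement

sign : List Step → List SStep
sign []      = []
sign (N ∷ w) = sN ∷ map plain w
sign (E ∷ w) = sE⁺ ∷ map plain w

star-sign : ∀ w → star (sign w) ≡ w
star-sign []      = refl
star-sign (N ∷ w) = cong (N ∷_) (star-plain w)
star-sign (E ∷ w) = cong (E ∷_) (star-plain w)

plain-Plain : ∀ w → Plain (map plain w)
plain-Plain []      = tt
plain-Plain (N ∷ w) = plain-Plain w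
plain-Plain (E ∷ w) = plain-Plain w

signOK-sign : ∀ w → SignOK (sign w)
signOK-sign []      = tt
signOK-sign (N ∷ w) = plain-Plain w
signOK-sign (E ∷ w) = plain-Plain w


-- This writes the starred map as `ζ` after the injective twist by `θ`, so that landing in the
-- ballot paths and injectivity are inherited from `ζ`.
record Factorisation (n : ℕ) (π : List SStep) : Set where
  field
    start   : ℕ
    middle  : List ℕ
    ends    : ℕ × ℕ
    star-eq : star π ≡ withTail start middle ends
    zeta-eq : star (zetaD n π) ≡ ζ n (withTail start middle (θ ends))
    inL     : InL n (withTail start middle (θ ends))

  twisted : List Step
  twisted = withTail start middle (θ ends)

factorise : ∀ n π → 3 ≤ n → InL n (star π) → Factorisation n π
factorise n π 3≤n l = from (split-tail n (star π) 3≤n l)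
  where
  from : (∃₂ λ e m → ∃₂ λ ms kl → star π ≡ withTail e (m ∷ ms) kl) → Factorisation n π
  from (e , m , ms , (k , l′) , eq) = record
    { start = e ; middle = m ∷ ms ; ends = k , l′ ; star-eq = eq
    ; zeta-eq = zetaD-twist n π e m ms k l′ eq l
    ; inL = withTail-InL n e (m ∷ ms) (k , l′) (θ (k , l′)) (sym (θ-sum k l′)) (subst (InL n) eq l)
    }

twisted-injective : ∀ {n π π′} (f : Factorisation n π) (g : Factorisation n π′) →
  Factorisation.twisted f ≡ Factorisation.twisted g → star π ≡ star π′
twisted-injective f g eq = trans F.star-eq (trans
  (untwist (withTail-injective F.start F.middle (θ F.ends) G.start G.middle (θ G.ends) eq))
  (sym G.star-eq))
  where
  module F = Factorisation f
  module G = Factorisation g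
  untwist : (F.start ≡ G.start) × (F.middle ≡ G.middle) × (θ F.ends ≡ θ G.ends) →
    withTail F.start F.middle F.ends ≡ withTail G.start G.middle G.ends
  untwist (e₁ , e₂ , e₃) = trans (cong₂ (λ e ms → withTail e ms F.ends) e₁ e₂)
    (cong (withTail G.start G.middle) (θ-injective F.ends G.ends e₃))

-- The right side of `zetaD-twist` involves only the runs of `star π`, so one splitting of that word
-- serves both signed paths.
star-determines-zetaD : ∀ n π π′ → 3 ≤ n → InL n (star π) → InL n (star π′) →
  star π ≡ star π′ → star (zetaD n π) ≡ star (zetaD n π′)
star-determines-zetaD n π π′ 3≤n l l′ eq = from (split-tail n (star π) 3≤n l)
  where
  from : (∃₂ λ e m → ∃₂ λ ms kl → star π ≡ withTail e (m ∷ ms) kl) → star (zetaD n π) ≡ star (zetaD n π′)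
  from (e , m , ms , (k , l″) , eq′) = trans (zetaD-twist n π e m ms k l″ eq′ l)
    (sym (zetaD-twist n π′ e m ms k l″ (trans (sym eq) eq′) l′))

zetaD-attains-ζ : ∀ n w → 3 ≤ n → InL n w → ∃ λ π → InLsigned n π × (star (zetaD n π) ≡ ζ n w)
zetaD-attains-ζ n w 3≤n l = from (split-tail n w 3≤n l)
  where
  from : (∃₂ λ e m → ∃₂ λ ms kl → w ≡ withTail e (m ∷ ms) kl) → ∃ λ π → InLsigned n π × (star (zetaD n π) ≡ ζ n w)
  from (e , m , ms , kl , eq) = sign v , (l′ , signOK-sign v) ,
    trans (zetaD-twist n (sign v) e m ms (proj₁ kl′) (proj₂ kl′) (star-sign v) l′)
      (cong (ζ n) (trans (cong (withTail e (m ∷ ms)) θ-kl′) (sym eq)))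
    where
    -- The twist has to turn the lift into `w`, so its last two runs are untwisted first.
    kl′ = θ⁻¹ kl
    v   = withTail e (m ∷ ms) kl′
    θ-kl′ : θ kl′ ≡ kl
    θ-kl′ = θ-θ⁻¹ (proj₁ kl) (proj₂ kl)
    l′ : InL n (star (sign v))
    l′ = subst (InL n) (sym (star-sign v)) (withTail-InL n e (m ∷ ms) kl kl′
      (trans (sym (cong (λ t → proj₁ t + proj₂ t) θ-kl′)) (θ-sum (proj₁ kl′) (proj₂ kl′))) (subst (InL n) eq l))

theorem5p24 : (n : ℕ) → 3 ≤ n →
    ((π π′ : List SStep) → InLsigned n π → InLsigned n π′ →
    star π ≡ star π′ → star (zetaD n π) ≡ star (zetaD n π′))
    × ((π : List SStep) → InLsigned n π → InB n (star (zetaD n π)))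
    × ((π π′ : List SStep) → InLsigned n π → InLsigned n π′ →
    star (zetaD n π) ≡ star (zetaD n π′) → star π ≡ star π′)
    × ((b : List Step) → InB n b →
    Σ (List SStep) (λ π → InLsigned n π × star (zetaD n π) ≡ b))
theorem5p24 n@(suc m) 3≤n = wellDefined , lands , injective , surjective
  where
  open Factorisation

  wellDefined : ∀ π π′ → InLsigned n π → InLsigned n π′ → star π ≡ star π′ → star (zetaD n π) ≡ star (zetaD n π′)
  wellDefined π π′ (l , _) (l′ , _) = star-determines-zetaD n π π′ 3≤n l l′

  lands : ∀ π → InLsigned n π → InB n (star (zetaD n π))
  lands π (l , _) = subst (InB n) (sym (zeta-eq f)) (ζ-ballot m (twisted f) (inL f))
    where f = factorise n π 3≤n l

  injective : ∀ π π′ → InLsigned n π → InLsigned n π′ → star (zetaD n π) ≡ star (zetaD n π′) → star π ≡ star π′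
  injective π π′ (l , _) (l′ , _) eq = twisted-injective f g (ζ-injective m (twisted f) (twisted g) (inL f) (inL g)
    (trans (sym (zeta-eq f)) (trans eq (zeta-eq g))))
    where
    f = factorise n π 3≤n l
    g = factorise n π′ 3≤n l′

  surjective : ∀ b → InB n b → Σ (List SStep) λ π → InLsigned n π × star (zetaD n π) ≡ b
  surjective b b∈B = proj₁ attained , proj₁ (proj₂ attained) , trans (proj₂ (proj₂ attained)) (proj₂ (proj₂ preimage))
    where
    preimage = ζ-surjective m b b∈B
    attained = zetaD-attains-ζ n (proj₁ preimage) 3≤n (proj₁ (proj₂ preimage))
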